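{- Let $\varepsilon\in(0,1]$, $\rho\ge0$, and let $(k_i,v_i)_{i=1}^n$ be a normalised instance with parameter $\rho$. There is an unweighted subset $S\subseteq[n]$ with $\sup_{\|q\|\le\rho}\|\mathrm{Attn}_S(q)-\mathrm{Attn}(q)\|_2\le\varepsilon$ and $|S|\le\min\{n,\lceil32e^{2\rho}/\varepsilon^2\rceil\}$. Moreover, a uniformly random subset $S\subseteq[n]$ of size $\min\{n,\lceil128e^{2\rho}/\varepsilon^2\rceil\}$ satisfies $\sup_{\|q\|\le\rho}\|\mathrm{Attn}_S(q)-\mathrm{Attn}(q)\|_2\le\varepsilon$ with probability at least $\tfrac34$.
   Context: Normalised instance with parameter $\rho$: keys $k_1,\dots,k_n\in\mathbb{R}^{d_k}$ and values $v_1,\dots,v_n\in\mathbb{R}^{d_v}$ ($n,d_k,d_v\ge1$) with $\frac1n\sum_i k_i=0$, $\|k_i\|\le1$, $\|v_i\|\le1$ (Euclidean norms); queries are the $q\in\mathbb{R}^{d_k}$ with $\|q\|\le\rho$. For nonempty $S\subseteq[n]$ put $\mathrm{Attn}_S(q)=\dfrac{\sum_{i\in S}e^{q^\top k_i}v_i}{\sum_{i\in S}e^{q^\top k_i}}$ and $\mathrm{Attn}=\mathrm{Attn}_{[n]}$. -}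

module Defs where

open import Algebra.Bundles using (CommutativeRing; Semiring)
open import Axiom.ExcludedMiddle using (ExcludedMiddle)
open import Data.Bool.Base using (if_then_else_)
open import Data.Fin.Base using (Fin; toℕ)
open import Data.Fin.Subset using (Subset; inside; outside; ⊤; ∣_∣)
open import Data.List.Base as List using (List; []; _∷_; _++_; filter; length)
open import Data.Nat.Base as ℕ using (ℕ; zero; suc; _!)
import Data.Nat.Properties as ℕ
open import Data.Product.Base using (∃; _,_) renaming (_×_ to _∧_)
open import Data.Vec.Base as Vec using (lookup)
open import Data.Vec.Functional using (Vector)
open import Level using (0ℓ)
open import Relation.Binary.Core using (Rel)
open import Relation.Binary.Structures using (IsTotalOrder)
open import Relation.Nullary using (¬_; yes; no)

-- The usual axioms for the real numbers: a nontrivial totally ordered field in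
-- which every inhabited subset that is bounded above has a least upper bound.
-- They determine ℝ up to isomorphism, so a statement about an arbitrary
-- such field is a statement about ℝ.

module _ {A : Set} (_≤_ : Rel A 0ℓ) where

  IsUpperBound : (A → Set) → A → Set
  IsUpperBound P b = ∀ x → P x → x ≤ b

  IsSupremum : (A → Set) → A → Set
  IsSupremum P s = IsUpperBound P s ∧ (∀ b → IsUpperBound P b → s ≤ b)

record CompleteOrderedField : Set₁ where
  infix 4 _≤_
  field
    commutativeRing : CommutativeRing 0ℓ 0ℓ

  open CommutativeRing commutativeRing public
    using (_≈_; _≉_; _+_; _*_; -_; _-_; 0#; 1#; semiring)
    renaming (Carrier to ℝ)

  field
    0≉1          : 0# ≉ 1#
    inverse      : ∀ x → x ≉ 0# → ∃ λ y → x * y ≈ 1#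
    _≤_          : Rel ℝ 0ℓ
    isTotalOrder : IsTotalOrder _≈_ _≤_
    +-monoˡ-≤    : ∀ z {x y} → x ≤ y → x + z ≤ y + z
    *-nonneg     : ∀ {x y} → 0# ≤ x → 0# ≤ y → 0# ≤ x * y
    complete     : (P : ℝ → Set) → ∃ P → ∃ (IsUpperBound _≤_ P) →
                   ∃ (IsSupremum _≤_ P)

allSubsets : ∀ n → List (Subset n)
allSubsets zero    = Vec.[] ∷ []
allSubsets (suc n) = List.map (outside Vec.∷_) (allSubsets n)
                  ++ List.map (inside  Vec.∷_) (allSubsets n)

subsetsOfSize : ∀ n → ℕ → List (Subset n)
subsetsOfSize n m = filter (λ S → ∣ S ∣ ℕ.≟ m) (allSubsets n)

module Attention (lem : ExcludedMiddle 0ℓ) (R : CompleteOrderedField) where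

  open CompleteOrderedField R public
  open import Algebra.Definitions.RawSemiring (Semiring.rawSemiring semiring) public
    using (_×_; _^_; sum)
  open import Relation.Binary.Construct.NonStrictToStrict _≈_ _≤_ public
    using (_<_)

  -- Partial operations are made total by a default value: 'choose d P' is some
  -- element satisfying P if there is one, and d otherwise.  Below, P
  -- determines its witness up to equality wherever one exists.
  choose : {A : Set} → A → (A → Set) → A
  choose d P with lem {∃ P}
  ... | yes (a , _) = a
  ... | no  _       = d

  fromℕ : ℕ → ℝ
  fromℕ n = n × 1#

  infix  9 _⁻¹
  infixl 7 _/_

  -- 0# ⁻¹ is 0#.
  _⁻¹ : ℝ → ℝ
  x ⁻¹ = choose 0# λ y → x * y ≈ 1#

  _/_ : ℝ → ℝ → ℝ
  x / y = x * y ⁻¹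

  -- The square root of a negative number is 0#.
  sqrt : ℝ → ℝ
  sqrt x = choose 0# λ y → (0# ≤ y) ∧ (y * y ≈ x)

  _⟶_ : (ℕ → ℝ) → ℝ → Set
  a ⟶ l = ∀ δ → 0# < δ → ∃ λ N → ∀ m → N ℕ.≤ m →
    (l - δ < a m) ∧ (a m < l + δ)

  -- The limit of a divergent sequence is 0#.
  lim : (ℕ → ℝ) → ℝ
  lim a = choose 0# (a ⟶_)

  exp : ℝ → ℝ
  exp x = lim λ N → sum {N} λ j → x ^ toℕ j / fromℕ (toℕ j !)

  -- The ceiling with values in ℕ: the ceiling of a negative number is 0.
  ⌈_⌉ : ℝ → ℕ
  ⌈ x ⌉ = choose 0 λ m → (x ≤ fromℕ m) ∧ (∀ k → x ≤ fromℕ k → m ℕ.≤ k)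

  ⟨_,_⟩ : ∀ {d} → Vector ℝ d → Vector ℝ d → ℝ
  ⟨ x , y ⟩ = sum λ c → x c * y c

  ∥_∥ : ∀ {d} → Vector ℝ d → ℝ
  ∥ x ∥ = sqrt ⟨ x , x ⟩

  record NormalisedInstance (n dₖ dᵥ : ℕ) : Set where
    field
      key         : Fin n → Vector ℝ dₖ
      value       : Fin n → Vector ℝ dᵥ
      key-centred : ∀ c → fromℕ n ⁻¹ * sum (λ i → key i c) ≈ 0#
      key-bound   : ∀ i → ∥ key i ∥ ≤ 1#
      value-bound : ∀ i → ∥ value i ∥ ≤ 1#

  sumOver : ∀ {n} → Subset n → (Fin n → ℝ) → ℝ
  sumOver S f = sum λ i → if lookup S i then f i else 0#

  module _ {n dₖ dᵥ : ℕ} (I : NormalisedInstance n dₖ dᵥ) where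
    open NormalisedInstance I

    -- Meaningful for nonempty S only.
    AttnOn : Subset n → Vector ℝ dₖ → Vector ℝ dᵥ
    AttnOn S q c = sumOver S (λ i → exp ⟨ q , key i ⟩ * value i c)
                 / sumOver S (λ i → exp ⟨ q , key i ⟩)

    Attn : Vector ℝ dₖ → Vector ℝ dᵥ
    Attn = AttnOn ⊤

    -- The set { ∥ AttnOn S q − Attn q ∥ : ∥ q ∥ ≤ ρ }.
    Error : ℝ → Subset n → ℝ → Set
    Error ρ S x = ∃ λ q →
      (∥ q ∥ ≤ ρ) ∧ (x ≈ ∥ (λ c → AttnOn S q c - Attn q c) ∥)

    -- The supremum of the set above exists and is at most ε.
    SupError≤ : ℝ → ℝ → Subset n → Set
    SupError≤ ρ ε S = ∃ λ s → IsSupremum _≤_ (Error ρ S) s ∧ (s ≤ ε)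

  -- Probability of E for an element drawn uniformly from the positions of Ω,
  -- hence uniformly from the elements when Ω has no repetitions.
  Pr : {A : Set} → List A → (A → Set) → ℝ
  Pr Ω E = fromℕ (length (filter (λ x → lem {E x}) Ω)) / fromℕ (length Ω)

{-# OPTIONS --safe #-}
-- Put wᵢ(q) = exp ⟨q, kᵢ⟩, let m = |S|, and give i the deviation aᵢ = n [i ∈ S] − m.
-- With D = Σᵢ wᵢ, X = Σᵢ aᵢ wᵢ vᵢ and Y = Σᵢ aᵢ wᵢ one has
-- m D (Attn_S − Attn) = X − Y Attn_S, where |Attn_S| ≤ 1, and D ≥ n because
-- exp x ≥ 1 + x and the keys are centred.  Hence
-- (m n)² |Attn_S − Attn|² ≤ 2 (|X|² + Y²).
--
-- To bound X and Y uniformly in q, write q = ρ p with |p| ≤ 1.  Expanding exp and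
-- applying Cauchy–Schwarz (⟨p, k⟩ʲ is an inner product of tensor powers) gives
-- (Σᵢ fᵢ wᵢ)² ≤ exp ρ · Σᵢₗ fᵢ fₗ exp (ρ ⟨kᵢ, kₗ⟩), so |X|² + Y² is at most
-- exp ρ times a positive semidefinite quadratic form in a that does not depend
-- on q.  For a uniformly random S of size m its mean is at most n m times its
-- trace, hence at most 2 n² m exp ρ, so Markov's inequality bounds the
-- probability of an error above ε by 4 exp (2ρ) / (m ε²).  This is at most 1/4
-- when m ε² ≥ 16 exp (2ρ), and the only other sample size is m = n, where a = 0.
module Submission where

open import Defs
open import Algebra.Bundles using (CommutativeRing)
open import Algebra.Solver.Ring.AlmostCommutativeRing
  using (AlmostCommutativeRing; fromCommutativeRing; _-Raw-AlmostCommutative⟶_)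
open import Axiom.ExcludedMiddle using (ExcludedMiddle)
open import Data.Bool.Base using (true; false; if_then_else_)
open import Data.Empty using (⊥-elim)
open import Data.Fin.Base using (Fin; zero; suc; toℕ)
import Data.Fin.Properties as Fin
open import Data.Fin.Subset using (Subset; Nonempty; inside; outside; ⊤; ∣_∣; _∈_)
import Data.Fin.Subset.Properties as Subset
open import Data.Integer.Base as ℤ using (ℤ; +_; -[1+_]; _⊖_; _◃_)
import Data.Integer.Properties as ℤ
open import Data.List.Base as List using (List; []; _∷_; _++_; filter; length)
open import Data.List.Properties using (filter-++; filter-≐; filter-none; ++-identityʳ; length-map; length-++)
open import Data.List.Relation.Unary.All as All using (All; []; _∷_)
open import Data.List.Relation.Unary.All.Properties using (all-filter; filter⁺)
open import Data.Maybe.Base using (just; nothing)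
open import Data.Nat.Base as ℕ using (ℕ; zero; suc; _⊓_; _!)
open import Data.Nat.Combinatorics using (_C_; nCk≡n!/k![n-k]!; k![n∸k]!∣n!)
open import Data.Nat.DivMod using (m/n*n≡m)
import Data.Nat.Properties as ℕ
open import Data.Product.Base using (∃; _,_; proj₁; proj₂) renaming (_×_ to _∧_)
import Data.Sign.Base as Sign
open import Data.Sum.Base as Sum using (_⊎_; inj₁; inj₂)
open import Data.Vec.Base as Vec using (lookup)
import Data.Vec.Properties as Vec
open import Function.Base using (_∘_)
open import Level using (0ℓ)
open import Relation.Binary.Bundles using (Poset)
import Relation.Binary.Construct.NonStrictToStrict as NonStrict
open import Relation.Binary.Definitions using (WeaklyDecidable)
open import Relation.Binary.PropositionalEquality as ≡ using (_≡_; _≢_)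
import Relation.Binary.Reasoning.PartialOrder as PartialOrderReasoning
import Relation.Binary.Reasoning.Setoid as SetoidReasoning
open import Relation.Binary.Structures using (IsTotalOrder)
open import Relation.Nullary using (¬_; yes; no; contradiction)
open import Relation.Nullary.Decidable.Core using (does)
open import Relation.Unary using (Decidable; Pred)

-- The obstacle is that one random set must serve all queries at once, and a net with a union bound
-- would bring in the dimension. Hence every error is dominated by one quantity that is free of q.
-- Multiplying the error by D, rather than by the normaliser of S, matters: D is at least n for
-- every q, whereas the sum over S is random and may be small. Writing q = ρ p makes ρ^j / j! the
-- weights of the series. Their total is one factor exp ρ, and the kernel diagonal exp (ρ |k|²)
-- supplies the other. Expanding in q itself would give exp (ρ² + 1) in place of exp (2ρ). The 4 in
-- front of exp (2ρ) is the 2 of (x - y)² ≤ 2 (x² + y²) times the bound 2 for |v|² + 1. Sampling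
-- without replacement only helps: the negative correlations contribute a multiple of -1ᵀH1, which
-- positive semidefiniteness makes nonpositive. Both 32 and 128 exceed 16, so one estimate yields
-- both claims, the first because a positive proportion of the sets is good.

module Proof (lem : ExcludedMiddle 0ℓ) (R : CompleteOrderedField) where

  -- Ordered fields

  open Attention lem R
  open CommutativeRing commutativeRing
    using (refl; sym; trans; setoid; +-cong; +-congˡ; +-congʳ; *-cong; *-congˡ; *-congʳ; -‿cong;
           +-identityˡ; +-identityʳ; *-identityˡ; +-comm; *-comm; *-assoc;
           zeroˡ; zeroʳ; reflexive; -‿inverseˡ; -‿inverseʳ; commutativeSemiring; ring; +-abelianGroup)
  open IsTotalOrder isTotalOrder using (isPartialOrder)
    renaming (refl to ≤-refl; reflexive to ≤-reflexive; trans to ≤-trans; antisym to ≤-antisym;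
              total to ≤-total; ≤-respˡ-≈ to ≤-respˡ; ≤-respʳ-≈ to ≤-respʳ)
  module < = NonStrict _≈_ _≤_

  ≤-poset : Poset 0ℓ 0ℓ 0ℓ
  ≤-poset = record { isPartialOrder = isPartialOrder }

  module ≤-Reasoning = PartialOrderReasoning ≤-poset
  module ≈-Reasoning = SetoidReasoning setoid

  -- Integer coefficients for the ring solver

  fromℕ-+ : ∀ m n → fromℕ (m ℕ.+ n) ≈ fromℕ m + fromℕ n
  fromℕ-+ = ×-homo-+ 1#
    where open import Algebra.Properties.Semiring.Mult semiring

  fromℕ-* : ∀ m n → fromℕ (m ℕ.* n) ≈ fromℕ m * fromℕ n
  fromℕ-* = ×1-homo-*
    where open import Algebra.Properties.Semiring.Mult semiring

  fromℤ : ℤ → ℝ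
  fromℤ (+ n)    = fromℕ n
  fromℤ -[1+ n ] = - fromℕ (suc n)

  almostRing : AlmostCommutativeRing 0ℓ 0ℓ
  almostRing = fromCommutativeRing commutativeRing

  module _ where
    open import Algebra.Properties.Ring ring
    open import Algebra.Properties.AbelianGroup +-abelianGroup
    open ≈-Reasoning

    fromℤ-⊖ : ∀ m n → fromℤ (m ⊖ n) ≈ fromℕ m - fromℕ n
    fromℤ-⊖ m       zero    = sym (trans (+-congˡ -0#≈0#) (+-identityʳ _))
    fromℤ-⊖ zero    (suc n) = sym (+-identityˡ _)
    fromℤ-⊖ (suc m) (suc n) = begin
      fromℤ (suc m ⊖ suc n)                    ≡⟨ ≡.cong fromℤ (ℤ.[1+m]⊖[1+n]≡m⊖n m n) ⟩
      fromℤ (m ⊖ n)                            ≈⟨ fromℤ-⊖ m n ⟩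
      fromℕ m - fromℕ n                        ≈⟨ +-congʳ (+-identityˡ _) ⟨
      (0# + fromℕ m) - fromℕ n                 ≈⟨ +-congʳ (+-congʳ (-‿inverseˡ 1#)) ⟨
      ((- 1# + 1#) + fromℕ m) - fromℕ n        ≈⟨ +-congʳ (C.+-assoc _ _ _) ⟩
      (- 1# + fromℕ (suc m)) - fromℕ n         ≈⟨ +-congʳ (+-comm _ _) ⟩
      (fromℕ (suc m) - 1#) - fromℕ n           ≈⟨ C.+-assoc _ _ _ ⟩
      fromℕ (suc m) + (- 1# + - fromℕ n)       ≈⟨ +-congˡ (⁻¹-∙-comm 1# (fromℕ n)) ⟩
      fromℕ (suc m) - fromℕ (suc n)            ∎
      where module C = CommutativeRing commutativeRing

    fromℤ-+ : ∀ i j → fromℤ (i ℤ.+ j) ≈ fromℤ i + fromℤ j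
    fromℤ-+ (+ m)    (+ n)    = fromℕ-+ m n
    fromℤ-+ (+ m)    -[1+ n ] = fromℤ-⊖ m (suc n)
    fromℤ-+ -[1+ m ] (+ n)    = trans (fromℤ-⊖ n (suc m)) (+-comm _ _)
    fromℤ-+ -[1+ m ] -[1+ n ] = begin
      - fromℕ (suc (suc (m ℕ.+ n)))       ≡⟨ ≡.cong (λ k → - fromℕ (suc k)) (ℕ.+-suc m n) ⟨
      - fromℕ (suc m ℕ.+ suc n)           ≈⟨ -‿cong (fromℕ-+ (suc m) (suc n)) ⟩
      - (fromℕ (suc m) + fromℕ (suc n))   ≈⟨ ⁻¹-∙-comm _ _ ⟨
      - fromℕ (suc m) + - fromℕ (suc n)   ∎

    fromℤ-neg : ∀ i → fromℤ (ℤ.- i) ≈ - fromℤ i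
    fromℤ-neg (+ zero)   = sym -0#≈0#
    fromℤ-neg (+ suc n)  = refl
    fromℤ-neg -[1+ n ]   = sym (-‿involutive _)

    fromℤ-+◃ : ∀ n → fromℤ (Sign.+ ◃ n) ≈ fromℕ n
    fromℤ-+◃ n = C.reflexive (≡.cong fromℤ (ℤ.+◃n≡+n n))
      where module C = CommutativeRing commutativeRing

    fromℤ--◃ : ∀ n → fromℤ (Sign.- ◃ n) ≈ - fromℕ n
    fromℤ--◃ zero    = sym -0#≈0#
    fromℤ--◃ (suc n) = refl

    fromℤ-* : ∀ i j → fromℤ (i ℤ.* j) ≈ fromℤ i * fromℤ j
    fromℤ-* (+ m)    (+ n)    = trans (fromℤ-+◃ (m ℕ.* n)) (fromℕ-* m n)
    fromℤ-* (+ m)    -[1+ n ] = trans (fromℤ--◃ (m ℕ.* suc n))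
      (trans (-‿cong (fromℕ-* m (suc n))) (-‿distribʳ-* _ _))
    fromℤ-* -[1+ m ] (+ n)    = trans (fromℤ--◃ (suc m ℕ.* n))
      (trans (-‿cong (fromℕ-* (suc m) n)) (-‿distribˡ-* _ _))
    fromℤ-* -[1+ m ] -[1+ n ] = trans (fromℤ-+◃ (suc m ℕ.* suc n)) (trans (fromℕ-* (suc m) (suc n)) (begin
      fromℕ (suc m) * fromℕ (suc n)          ≈⟨ -‿involutive _ ⟨
      - - (fromℕ (suc m) * fromℕ (suc n))    ≈⟨ -‿cong (-‿distribʳ-* _ _) ⟩
      - (fromℕ (suc m) * - fromℕ (suc n))    ≈⟨ -‿distribˡ-* _ _ ⟩
      - fromℕ (suc m) * - fromℕ (suc n)      ∎))

  -- Interprets 1 by 1# rather than by 1# + 0#.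
  coefficient : ℤ → ℝ
  coefficient (+ 1)             = 1#
  coefficient (+ zero)          = 0#
  coefficient (+ (suc (suc n))) = fromℕ (suc (suc n))
  coefficient -[1+ n ]          = - fromℕ (suc n)

  coefficient≈fromℤ : ∀ i → coefficient i ≈ fromℤ i
  coefficient≈fromℤ (+ 1)             = sym (+-identityʳ 1#)
  coefficient≈fromℤ (+ zero)          = refl
  coefficient≈fromℤ (+ (suc (suc n))) = refl
  coefficient≈fromℤ -[1+ n ]          = refl

  coefficient-homomorphism : ℤ.+-*-rawRing -Raw-AlmostCommutative⟶ almostRing
  coefficient-homomorphism = record
    { ⟦_⟧    = coefficient
    ; +-homo = λ i j → trans (coefficient≈fromℤ (i ℤ.+ j)) (trans (fromℤ-+ i j)
                 (+-cong (sym (coefficient≈fromℤ i)) (sym (coefficient≈fromℤ j))))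
    ; *-homo = λ i j → trans (coefficient≈fromℤ (i ℤ.* j)) (trans (fromℤ-* i j)
                 (*-cong (sym (coefficient≈fromℤ i)) (sym (coefficient≈fromℤ j))))
    ; -‿homo = λ i → trans (coefficient≈fromℤ (ℤ.- i)) (trans (fromℤ-neg i)
                 (-‿cong (sym (coefficient≈fromℤ i))))
    ; 0-homo = refl
    ; 1-homo = refl
    }

  coefficient-≟ : WeaklyDecidable (λ i j → coefficient i ≈ coefficient j)
  coefficient-≟ i j with i ℤ.≟ j
  ... | yes ≡.refl = just refl
  ... | no  _      = nothing

  open import Algebra.Solver.Ring ℤ.+-*-rawRing almostRing coefficient-homomorphism coefficient-≟
    using (solve; _:=_; _:+_; _:*_; _:-_; :-_; con)

  -- Totalised operations, order and division

  choose-spec : ∀ {A : Set} {d : A} {P : A → Set} → ∃ P → P (choose d P)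
  choose-spec {P = P} ∃P with lem {∃ P}
  ... | yes (_ , p) = p
  ... | no  ¬∃P     = contradiction ∃P ¬∃P

  ≤-or-> : ∀ x y → x ≤ y ⊎ y < x
  ≤-or-> x y with lem {x ≤ y}
  ... | yes p = inj₁ p
  ... | no  p = inj₂ (<.≰⇒> sym ≤-reflexive ≤-total p)

  <⇒≱ : ∀ {x y} → x < y → ¬ (y ≤ x)
  <⇒≱ = <.<⇒≱ ≤-antisym

  ≮⇒≥ : ∀ {x y} → ¬ (x < y) → y ≤ x
  ≮⇒≥ {x} {y} p with ≤-or-> y x
  ... | inj₁ q = q
  ... | inj₂ q = contradiction q p

  <-≤-trans : ∀ {x y z} → x < y → y ≤ z → x < z
  <-≤-trans = <.<-≤-trans sym ≤-trans ≤-antisym ≤-respʳ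

  ≤-<-trans : ∀ {x y z} → x ≤ y → y < z → x < z
  ≤-<-trans = <.≤-<-trans ≤-trans ≤-antisym ≤-respˡ

  +-mono-≤ : ∀ {w x y z} → w ≤ x → y ≤ z → w + y ≤ x + z
  +-mono-≤ {w} {x} {y} {z} w≤x y≤z = begin
    w + y  ≤⟨ +-monoˡ-≤ y w≤x ⟩
    x + y  ≈⟨ +-comm x y ⟩
    y + x  ≤⟨ +-monoˡ-≤ x y≤z ⟩
    z + x  ≈⟨ +-comm z x ⟩
    x + z  ∎
    where open ≤-Reasoning

  +-nonneg : ∀ {x y} → 0# ≤ x → 0# ≤ y → 0# ≤ x + y
  +-nonneg p q = ≤-respˡ (+-identityˡ 0#) (+-mono-≤ p q)

  -- The standard route to an inequality below: the ring solver rewrites the difference as an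
  -- expression `z` that is visibly nonnegative.
  y-x≈z≥0⇒x≤y : ∀ {x y z} → 0# ≤ z → y - x ≈ z → x ≤ y
  y-x≈z≥0⇒x≤y {x} {y} {z} 0≤z eq = begin
    x            ≈⟨ +-identityˡ x ⟨
    0# + x       ≤⟨ +-monoˡ-≤ x 0≤z ⟩
    z + x        ≈⟨ +-congʳ eq ⟨
    (y - x) + x  ≈⟨ solve 2 (λ x y → (y :- x) :+ x := y) refl x y ⟩
    y            ∎
    where open ≤-Reasoning

  0≤y-x⇒x≤y : ∀ {x y} → 0# ≤ y - x → x ≤ y
  0≤y-x⇒x≤y p = y-x≈z≥0⇒x≤y p refl

  x≤y⇒0≤y-x : ∀ {x y} → x ≤ y → 0# ≤ y - x
  x≤y⇒0≤y-x {x} {y} p = ≤-respˡ (-‿inverseʳ x) (+-monoˡ-≤ (- x) p)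

  *-monoˡ-≤ : ∀ {x y z} → 0# ≤ z → x ≤ y → z * x ≤ z * y
  *-monoˡ-≤ {x} {y} {z} 0≤z x≤y = y-x≈z≥0⇒x≤y (*-nonneg 0≤z (x≤y⇒0≤y-x x≤y))
    (solve 3 (λ x y z → z :* y :- z :* x := z :* (y :- x)) refl x y z)

  *-monoʳ-≤ : ∀ {x y z} → 0# ≤ z → x ≤ y → x * z ≤ y * z
  *-monoʳ-≤ {x} {y} {z} 0≤z x≤y = y-x≈z≥0⇒x≤y (*-nonneg 0≤z (x≤y⇒0≤y-x x≤y))
    (solve 3 (λ x y z → y :* z :- x :* z := z :* (y :- x)) refl x y z)

  *-mono-≤ : ∀ {w x y z} → 0# ≤ w → 0# ≤ z → w ≤ x → y ≤ z → w * y ≤ x * z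
  *-mono-≤ 0≤w 0≤z w≤x y≤z = ≤-trans (*-monoˡ-≤ 0≤w y≤z) (*-monoʳ-≤ 0≤z w≤x)

  x²≥0 : ∀ x → 0# ≤ x * x
  x²≥0 x with ≤-total 0# x
  ... | inj₁ p = *-nonneg p p
  ... | inj₂ p = ≤-respʳ (solve 1 (λ x → (con (+ 0) :- x) :* (con (+ 0) :- x) := x :* x) refl x)
                   (*-nonneg (x≤y⇒0≤y-x p) (x≤y⇒0≤y-x p))

  0≤1 : 0# ≤ 1#
  0≤1 = ≤-respʳ (*-identityˡ 1#) (x²≥0 1#)

  0<1 : 0# < 1#
  0<1 = 0≤1 , 0≉1

  +-pos-nonneg : ∀ {x y} → 0# < x → 0# ≤ y → 0# < x + y
  +-pos-nonneg {x} {y} 0<x 0≤y = <-≤-trans 0<x (y-x≈z≥0⇒x≤y 0≤y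
    (solve 2 (λ x y → (x :+ y) :- x := y) refl x y))

  ⁻¹-inverse : ∀ {x} → x ≉ 0# → x * x ⁻¹ ≈ 1#
  ⁻¹-inverse {x} p = choose-spec {d = 0#} (inverse x p)

  0<⇒≉0 : ∀ {x} → 0# < x → x ≉ 0#
  0<⇒≉0 p q = <.<⇒≉ p (sym q)

  *-cancelˡ : ∀ {x y z} → x ≉ 0# → x * y ≈ x * z → y ≈ z
  *-cancelˡ {x} {y} {z} x≉0 eq = begin
    y                ≈⟨ *-identityˡ y ⟨
    1# * y           ≈⟨ *-congʳ (⁻¹-inverse x≉0) ⟨
    (x * x ⁻¹) * y   ≈⟨ swap x (x ⁻¹) y ⟩
    x ⁻¹ * (x * y)   ≈⟨ *-congˡ eq ⟩
    x ⁻¹ * (x * z)   ≈⟨ swap x (x ⁻¹) z ⟨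
    (x * x ⁻¹) * z   ≈⟨ *-congʳ (⁻¹-inverse x≉0) ⟩
    1# * z           ≈⟨ *-identityˡ z ⟩
    z                ∎
    where
    open ≈-Reasoning
    swap : ∀ x y z → (x * y) * z ≈ y * (x * z)
    swap = solve 3 (λ x y z → (x :* y) :* z := y :* (x :* z)) refl

  *-pos : ∀ {x y} → 0# < x → 0# < y → 0# < x * y
  *-pos {x} {y} 0<x 0<y = *-nonneg (proj₁ 0<x) (proj₁ 0<y) , λ 0≈xy →
    <.<⇒≉ 0<y (*-cancelˡ (0<⇒≉0 0<x) (trans (zeroʳ x) 0≈xy))

  ⁻¹-pos : ∀ {x} → 0# < x → 0# < x ⁻¹
  ⁻¹-pos {x} 0<x with ≤-or-> (x ⁻¹) 0#
  ... | inj₂ p = p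
  ... | inj₁ p = contradiction
    (≤-respʳ (zeroʳ x) (≤-respˡ (⁻¹-inverse (0<⇒≉0 0<x)) (*-monoˡ-≤ (proj₁ 0<x) p)))
    (<⇒≱ 0<1)

  *-cancelˡ-≤ : ∀ {x y z} → 0# < x → x * y ≤ x * z → y ≤ z
  *-cancelˡ-≤ {x} {y} {z} 0<x xy≤xz with ≤-or-> y z
  ... | inj₁ p = p
  ... | inj₂ p = ≤-reflexive (*-cancelˡ (0<⇒≉0 0<x) (≤-antisym xy≤xz (*-monoˡ-≤ (proj₁ 0<x) (proj₁ p))))

  /-*-cancel : ∀ {x y} → y ≉ 0# → y * (x / y) ≈ x
  /-*-cancel {x} {y} p = trans (solve 3 (λ x y z → y :* (x :* z) := (y :* z) :* x) refl x y (y ⁻¹))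
    (trans (*-congʳ (⁻¹-inverse p)) (*-identityˡ x))

  /-pos : ∀ {x y} → 0# < x → 0# < y → 0# < x / y
  /-pos p q = *-pos p (⁻¹-pos q)

  -- By contradiction: `y < x` with `y` nonnegative makes `(x - y) * (x + y)` positive.
  x²≤y²⇒x≤y : ∀ {x y} → 0# ≤ y → x * x ≤ y * y → x ≤ y
  x²≤y²⇒x≤y {x} {y} 0≤y le with ≤-or-> x y
  ... | inj₁ p = p
  ... | inj₂ p = ⊥-elim (<⇒≱ pos (≤-respʳ (-‿inverseʳ (y * y)) (+-monoˡ-≤ (- (y * y)) le)))
    where
    pos : 0# < x * x - y * y
    pos = <.<-respʳ-≈ sym trans ≤-respʳ
      (solve 2 (λ x y → (x :- y) :* (x :+ y) := x :* x :- y :* y) refl x y)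
      (*-pos (x≤y⇒0≤y-x (proj₁ p) , λ e → proj₂ p (trans (sym (+-identityʳ y)) (trans (+-congˡ e)
               (solve 2 (λ x y → y :+ (x :- y) := x) refl x y))))
             (+-pos-nonneg (≤-<-trans 0≤y p) 0≤y))

  fromℕ-nonneg : ∀ n → 0# ≤ fromℕ n
  fromℕ-nonneg zero    = ≤-refl
  fromℕ-nonneg (suc n) = +-nonneg 0≤1 (fromℕ-nonneg n)

  fromℕ-pos : ∀ {n} → 1 ℕ.≤ n → 0# < fromℕ n
  fromℕ-pos {suc n} _ = +-pos-nonneg 0<1 (fromℕ-nonneg n)

  fromℕ-mono-≤ : ∀ {m n} → m ℕ.≤ n → fromℕ m ≤ fromℕ n
  fromℕ-mono-≤ {n = n} ℕ.z≤n = fromℕ-nonneg n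
  fromℕ-mono-≤ (ℕ.s≤s p) = +-mono-≤ ≤-refl (fromℕ-mono-≤ p)

  -- Sums and limits

  open import Algebra.Properties.Semiring.Sum semiring
    using (∑-comm; *-distribˡ-sum; *-distribʳ-sum)
    renaming (sum-cong-≋ to sum-cong; ∑-distrib-+ to sum-distrib-+)

  sum-mono : ∀ {n} {f g : Fin n → ℝ} → (∀ i → f i ≤ g i) → sum f ≤ sum g
  sum-mono {zero}  p = ≤-refl
  sum-mono {suc n} p = +-mono-≤ (p zero) (sum-mono (λ i → p (suc i)))

  sum-nonneg : ∀ {n} {f : Fin n → ℝ} → (∀ i → 0# ≤ f i) → 0# ≤ sum f
  sum-nonneg {zero}  p = ≤-refl
  sum-nonneg {suc n} p = +-nonneg (p zero) (sum-nonneg (λ i → p (suc i)))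

  sum-zero : ∀ {n} {f : Fin n → ℝ} → (∀ i → f i ≈ 0#) → sum f ≈ 0#
  sum-zero {zero}  p = refl
  sum-zero {suc n} p = trans (+-cong (p zero) (sum-zero (λ i → p (suc i)))) (+-identityˡ 0#)

  sum-const : ∀ n x → sum {n} (λ _ → x) ≈ fromℕ n * x
  sum-const zero    x = sym (zeroˡ x)
  sum-const (suc n) x = trans (+-congˡ (sum-const n x))
    (solve 2 (λ n x → x :+ n :* x := (con (+ 1) :+ n) :* x) refl (fromℕ n) x)

  sum-neg : ∀ {n} (f : Fin n → ℝ) → sum (λ i → - f i) ≈ - sum f
  sum-neg {zero}  f = solve 0 (con (+ 0) := :- con (+ 0)) refl
  sum-neg {suc n} f = trans (+-congˡ (sum-neg (λ i → f (suc i))))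
    (solve 2 (λ x y → :- x :+ :- y := :- (x :+ y)) refl (f zero) (sum (λ i → f (suc i))))

  sum-distrib-- : ∀ {n} (f g : Fin n → ℝ) → sum (λ i → f i - g i) ≈ sum f - sum g
  sum-distrib-- f g = trans (sum-distrib-+ f (λ i → - g i)) (+-congˡ (sum-neg g))

  ∑< : ℕ → (ℕ → ℝ) → ℝ
  ∑< N f = sum {N} λ j → f (toℕ j)

  ∑<-suc : ∀ N f → ∑< (suc N) f ≈ ∑< N f + f N
  ∑<-suc zero    f = +-comm (f 0) 0#
  ∑<-suc (suc N) f = trans (+-congˡ (∑<-suc N (λ j → f (suc j))))
    (solve 3 (λ x y z → x :+ (y :+ z) := (x :+ y) :+ z) refl (f 0) (∑< N (λ j → f (suc j))) (f (suc N)))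

  -- Encodes |x| ≤ b by two inequalities. Such bounds pass termwise from a series to its majorant,
  -- which is how `exp` at arguments of either sign is reduced to nonnegative arguments.
  Within : ℝ → ℝ → Set
  Within x b = (- b ≤ x) ∧ (x ≤ b)

  within-resp : ∀ {x y b c} → x ≈ y → b ≈ c → Within x b → Within y c
  within-resp x≈y b≈c (p , q) =
    ≤-respʳ x≈y (≤-respˡ (-‿cong b≈c) p) , ≤-respʳ b≈c (≤-respˡ x≈y q)

  within-mono : ∀ {x b c} → b ≤ c → Within x b → Within x c
  within-mono {x} {b} {c} b≤c (p , q) = ≤-trans
    (y-x≈z≥0⇒x≤y (x≤y⇒0≤y-x b≤c) (solve 2 (λ b c → (:- b) :- (:- c) := c :- b) refl b c)) p , ≤-trans q b≤c

  within-+ : ∀ {x y b c} → Within x b → Within y c → Within (x + y) (b + c)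
  within-+ {x} {y} {b} {c} (p , q) (r , s) =
    ≤-respˡ (solve 2 (λ b c → :- b :+ :- c := :- (b :+ c)) refl b c) (+-mono-≤ p r) , +-mono-≤ q s

  within-sum : ∀ {n} {f g : Fin n → ℝ} → (∀ i → Within (f i) (g i)) → Within (sum f) (sum g)
  within-sum {zero}  p = ≤-reflexive (solve 0 (:- con (+ 0) := con (+ 0)) refl) , ≤-refl
  within-sum {suc n} p = within-+ (p zero) (within-sum (λ i → p (suc i)))

  within-neg : ∀ {x b} → Within x b → Within (- x) b
  within-neg {x} {b} (p , q) =
      y-x≈z≥0⇒x≤y (x≤y⇒0≤y-x q) (solve 2 (λ x b → (:- x) :- (:- b) := b :- x) refl x b)
    , y-x≈z≥0⇒x≤y (x≤y⇒0≤y-x p) (solve 2 (λ x b → b :- (:- x) := x :- (:- b)) refl x b)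

  x+x≥0⇒x≥0 : ∀ {x} → 0# ≤ x + x → 0# ≤ x
  x+x≥0⇒x≥0 {x} p with ≤-or-> 0# x
  ... | inj₁ q = q
  ... | inj₂ q = ⊥-elim (<⇒≱ (≤-<-trans (+-mono-≤ (proj₁ q) ≤-refl) (<.<-respˡ-≈ trans ≤-respˡ (sym (+-identityˡ x)) q)) p)

  -- No case split on signs: 2 (b c + x y) = (b - x)(c - y) + (b + x)(c + y) and 2 (b c - x y) = (b
  -- - x)(c + y) + (b + x)(c - y), and every factor on the right is nonnegative.
  within-* : ∀ {x y b c} → Within x b → Within y c → Within (x * y) (b * c)
  within-* {x} {y} {b} {c} (p , q) (r , s) =
      0≤y-x⇒x≤y (x+x≥0⇒x≥0 (≤-respʳ
        (solve 4 (λ x y b c → (b :- x) :* (c :- y) :+ (x :- :- b) :* (y :- :- c)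
                   := (x :* y :- :- (b :* c)) :+ (x :* y :- :- (b :* c))) refl x y b c)
        (+-nonneg (*-nonneg (x≤y⇒0≤y-x q) (x≤y⇒0≤y-x s)) (*-nonneg (x≤y⇒0≤y-x p) (x≤y⇒0≤y-x r)))))
    , 0≤y-x⇒x≤y (x+x≥0⇒x≥0 (≤-respʳ
        (solve 4 (λ x y b c → (b :- x) :* (y :- :- c) :+ (x :- :- b) :* (c :- y)
                   := (b :* c :- x :* y) :+ (b :* c :- x :* y)) refl x y b c)
        (+-nonneg (*-nonneg (x≤y⇒0≤y-x q) (x≤y⇒0≤y-x r)) (*-nonneg (x≤y⇒0≤y-x p) (x≤y⇒0≤y-x s)))))

  nonneg⇒within : ∀ {x} → 0# ≤ x → Within x x
  nonneg⇒within {x} p = y-x≈z≥0⇒x≤y (+-nonneg p p) (solve 1 (λ x → x :- :- x := x :+ x) refl x) , ≤-refl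

  within-bound : ∀ x → ∃ λ b → (0# ≤ b) ∧ Within x b
  within-bound x with ≤-total 0# x
  ... | inj₁ p = x , p , nonneg⇒within p
  ... | inj₂ p = - x , q , within-resp (solve 1 (λ x → :- :- x := x) refl x) refl (within-neg (nonneg⇒within q))
    where
    q : 0# ≤ - x
    q = ≤-respʳ (+-identityˡ (- x)) (x≤y⇒0≤y-x p)

  -- The witness δ / (δ + c) covers c = 0 without a separate case. As (δ + c) η = δ, the two bounds
  -- amount to δ ≤ δ + c and η c ≤ η (δ + c).
  shrink : ∀ {δ c} → 0# < δ → 0# ≤ c → ∃ λ η → (0# < η) ∧ (η ≤ 1#) ∧ (η * c ≤ δ)
  shrink {δ} {c} 0<δ 0≤c = η , 0<η , *-cancelˡ-≤ 0<δ+c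
      (y-x≈z≥0⇒x≤y 0≤c (trans (+-congˡ (-‿cong e)) (solve 2 (λ δ c → (δ :+ c) :* con (+ 1) :- δ := c) refl δ c)))
    , y-x≈z≥0⇒x≤y (*-nonneg (proj₁ 0<δ) (proj₁ 0<η)) (trans (+-congʳ (sym e))
        (solve 3 (λ δ c η → (δ :+ c) :* η :- η :* c := δ :* η) refl δ c η))
    where
    η = δ / (δ + c)
    0<δ+c : 0# < δ + c
    0<δ+c = +-pos-nonneg 0<δ 0≤c
    0<η : 0# < η
    0<η = /-pos 0<δ 0<δ+c
    e : (δ + c) * η ≈ δ
    e = /-*-cancel (0<⇒≉0 0<δ+c)

  x<x+y : ∀ {x y} → 0# < y → x < x + y
  x<x+y {x} {y} 0<y = y-x≈z≥0⇒x≤y (proj₁ 0<y) (solve 2 (λ x y → (x :+ y) :- x := y) refl x y) , λ e →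
    proj₂ 0<y (trans (sym (-‿inverseʳ x)) (trans (+-congʳ e) (solve 2 (λ x y → (x :+ y) :- x := y) refl x y)))

  x-y<x : ∀ {x y} → 0# < y → x - y < x
  x-y<x {x} {y} 0<y = <.<-respʳ-≈ sym trans ≤-respʳ (solve 2 (λ x y → (x :- y) :+ y := x) refl x y) (x<x+y 0<y)

  half : ∀ {δ} → 0# < δ → ∃ λ η → (0# < η) ∧ (η + η ≤ δ) ∧ (η < δ)
  half {δ} 0<δ = let η , 0<η , _ , p = shrink 0<δ (fromℕ-nonneg 2)
                     q = ≤-respˡ (solve 1 (λ η → η :* con (+ 2) := η :+ η) refl η) p
                 in η , 0<η , q , <-≤-trans (x<x+y 0<η) q

  +-monoʳ-< : ∀ {x y} z → x < y → z + x < z + y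
  +-monoʳ-< {x} {y} z (p , q) = ≤-respˡ (+-comm x z) (≤-respʳ (+-comm y z) (+-monoˡ-≤ z p)) , λ e →
    q (trans (solve 2 (λ z x → x := (z :+ x) :- z) refl z x)
      (trans (+-congʳ e) (solve 2 (λ z x → (z :+ x) :- z := x) refl z y)))

  neg-mono-< : ∀ {x y} → x < y → - y < - x
  neg-mono-< {x} {y} (p , q) = y-x≈z≥0⇒x≤y (x≤y⇒0≤y-x p) (solve 2 (λ x y → :- x :- :- y := y :- x) refl x y) , λ e →
    q (trans (solve 1 (λ x → x := :- :- x) refl x) (trans (-‿cong (sym e)) (solve 1 (λ x → :- :- x := x) refl y)))

  -- Convergence is defined with strict inequalities. Passing to a smaller η < δ recovers them from
  -- weak ones, so together with `⟶-elim` all limit laws can be argued with `Within`.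
  ⟶-intro : ∀ {a l} → (∀ δ → 0# < δ → ∃ λ N → ∀ m → N ℕ.≤ m → Within (a m - l) δ) → a ⟶ l
  ⟶-intro {a} {l} h δ 0<δ =
    let η , 0<η , _ , η<δ = half 0<δ
        N , p = h η 0<η
    in N , λ m N≤m → let r , s = p m N≤m in
      <-≤-trans (+-monoʳ-< l (neg-mono-< η<δ))
        (y-x≈z≥0⇒x≤y (x≤y⇒0≤y-x r) (solve 3 (λ a l η → a :- (l :- η) := (a :- l) :- :- η) refl (a m) l η))
    , ≤-<-trans
        (y-x≈z≥0⇒x≤y (x≤y⇒0≤y-x s) (solve 3 (λ a l η → (l :+ η) :- a := η :- (a :- l)) refl (a m) l η))
        (+-monoʳ-< l η<δ)

  ⟶-elim : ∀ {a l} → a ⟶ l → ∀ δ → 0# < δ → ∃ λ N → ∀ m → N ℕ.≤ m → Within (a m - l) δ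
  ⟶-elim {a} {l} h δ 0<δ = let N , p = h δ 0<δ in N , λ m N≤m → let (r , _) , (s , _) = p m N≤m in
      y-x≈z≥0⇒x≤y (x≤y⇒0≤y-x r) (solve 3 (λ a l δ → (a :- l) :- :- δ := a :- (l :- δ)) refl (a m) l δ)
    , y-x≈z≥0⇒x≤y (x≤y⇒0≤y-x s) (solve 3 (λ a l δ → δ :- (a :- l) := (l :+ δ) :- a) refl (a m) l δ)

  ⟶-cong : ∀ {a b l m} → (∀ i → a i ≈ b i) → l ≈ m → a ⟶ l → b ⟶ m
  ⟶-cong a≈b l≈m h = ⟶-intro λ δ 0<δ → let N , p = ⟶-elim h δ 0<δ in
    N , λ m N≤m → within-resp (+-cong (a≈b m) (-‿cong l≈m)) refl (p m N≤m)

  ⟶-const : ∀ l → (λ _ → l) ⟶ l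
  ⟶-const l = ⟶-intro λ δ 0<δ → 0 , λ _ _ →
    within-resp (sym (-‿inverseʳ l)) refl (within-mono (proj₁ 0<δ) (nonneg⇒within ≤-refl))

  ⟶-+ : ∀ {a b l m} → a ⟶ l → b ⟶ m → (λ i → a i + b i) ⟶ (l + m)
  ⟶-+ {a} {b} {l} {m} f g = ⟶-intro λ δ 0<δ →
    let η , 0<η , 2η≤δ , _ = half 0<δ
        M , p = ⟶-elim f η 0<η
        N , q = ⟶-elim g η 0<η
    in M ℕ.⊔ N , λ i le → within-mono 2η≤δ (within-resp
      (solve 4 (λ a b l m → (a :- l) :+ (b :- m) := (a :+ b) :- (l :+ m)) refl (a i) (b i) l m) refl
      (within-+ (p i (ℕ.m⊔n≤o⇒m≤o M N le)) (q i (ℕ.m⊔n≤o⇒n≤o M N le))))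

  -- From a b - l m = (a - l)(b - m) + l (b - m) + (a - l) m, with both factors within η of their
  -- limits. The condition η ≤ 1 turns η² into η, so the error is at most η (1 + K + L), which
  -- `shrink` makes at most δ.
  ⟶-* : ∀ {a b l m} → a ⟶ l → b ⟶ m → (λ i → a i * b i) ⟶ (l * m)
  ⟶-* {a} {b} {l} {m} f g = ⟶-intro λ δ 0<δ →
    let K , 0≤K , l≤K = within-bound l
        L , 0≤L , m≤L = within-bound m
        η , 0<η , η≤1 , ηc≤δ = shrink 0<δ (+-nonneg 0≤1 (+-nonneg 0≤K 0≤L))
        M , p = ⟶-elim f η 0<η
        N , q = ⟶-elim g η 0<η
    in M ℕ.⊔ N , λ i le →
       let u = p i (ℕ.m⊔n≤o⇒m≤o M N le)
           v = q i (ℕ.m⊔n≤o⇒n≤o M N le)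
       in within-mono ηc≤δ (within-resp
         (solve 4 (λ a b l m → (a :- l) :* (b :- m) :+ (l :* (b :- m) :+ (a :- l) :* m) := a :* b :- l :* m)
            refl (a i) (b i) l m)
         (solve 3 (λ η K L → η :* con (+ 1) :+ (K :* η :+ η :* L) := η :* (con (+ 1) :+ (K :+ L))) refl η K L)
         (within-+ (within-mono (*-monoˡ-≤ (proj₁ 0<η) η≤1) (within-* u v))
                   (within-+ (within-* l≤K v) (within-* u m≤L))))

  ⟶-- : ∀ {a b l m} → a ⟶ l → b ⟶ m → (λ i → a i - b i) ⟶ (l - m)
  ⟶-- {a} {b} {l} {m} f g = ⟶-cong (λ i → e (a i) (b i)) (e l m) (⟶-+ f (⟶-* (⟶-const (- 1#)) g))
    where
    e : ∀ x y → x + - 1# * y ≈ x - y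
    e = solve 2 (λ x y → x :+ :- con (+ 1) :* y := x :- y) refl

  ⟶-sum : ∀ {n} {a : Fin n → ℕ → ℝ} {l : Fin n → ℝ} →
          (∀ i → a i ⟶ l i) → (λ N → sum (λ i → a i N)) ⟶ sum l
  ⟶-sum {zero}  h = ⟶-const 0#
  ⟶-sum {suc n} h = ⟶-+ (h zero) (⟶-sum (λ i → h (suc i)))

  ⟶-mono-≤ : ∀ {a b l m} → (∀ i → a i ≤ b i) → a ⟶ l → b ⟶ m → l ≤ m
  ⟶-mono-≤ {a} {b} {l} {m} a≤b f g with ≤-or-> l m
  ... | inj₁ p = p
  ... | inj₂ (m≤l , m≉l) =
    let δ = l - m
        0<δ : 0# < δ
        0<δ = x≤y⇒0≤y-x m≤l , λ e → m≉l (trans (trans (sym (+-identityʳ m)) (+-congˡ e))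
                (solve 2 (λ m l → m :+ (l :- m) := l) refl m l))
        η , 0<η , 2η≤δ , _ = half 0<δ
        M , p = f η 0<η
        N , q = g η 0<η
        i = M ℕ.⊔ N
        lo = proj₁ (p i (ℕ.m≤m⊔n M N))
        hi = proj₂ (q i (ℕ.m≤n⊔m M N))
    in ⊥-elim (<⇒≱ (<-≤-trans lo (≤-trans (a≤b i) (proj₁ hi)))
         (y-x≈z≥0⇒x≤y (x≤y⇒0≤y-x 2η≤δ)
           (solve 3 (λ l m η → (l :- η) :- (m :+ η) := (l :- m) :- (η :+ η)) refl l m η)))

  ⟶-unique : ∀ {a l m} → a ⟶ l → a ⟶ m → l ≈ m
  ⟶-unique f g = ≤-antisym (⟶-mono-≤ (λ _ → ≤-refl) f g) (⟶-mono-≤ (λ _ → ≤-refl) g f)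

  ⟶-squeeze : ∀ {a b r l} → (∀ i → Within (a i - b i) (r i)) → r ⟶ 0# → b ⟶ l → a ⟶ l
  ⟶-squeeze {a} {b} {r} {l} h f g = ⟶-intro λ δ 0<δ →
    let η , 0<η , 2η≤δ , _ = half 0<δ
        M , p = ⟶-elim f η 0<η
        N , q = ⟶-elim g η 0<η
    in M ℕ.⊔ N , λ i le → within-mono 2η≤δ (within-resp
      (solve 3 (λ a b l → (a :- b) :+ (b :- l) := a :- l) refl (a i) (b i) l) refl
      (within-+ (within-mono (≤-respˡ (solve 1 (λ r → r :- con (+ 0) := r) refl (r i))
                                (proj₂ (p i (ℕ.m⊔n≤o⇒m≤o M N le)))) (h i))
                (q i (ℕ.m⊔n≤o⇒n≤o M N le))))

  monotone-convergence : ∀ {u : ℕ → ℝ} {b} → (∀ n → u n ≤ u (suc n)) → (∀ n → u n ≤ b) → ∃ (u ⟶_)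
  monotone-convergence {u} {b} step bounded = s , λ δ 0<δ → converge δ 0<δ
    where
    mono : ∀ {m n} → m ℕ.≤′ n → u m ≤ u n
    mono ℕ.≤′-refl     = ≤-refl
    mono (ℕ.≤′-step p) = ≤-trans (mono p) (step _)
    sup : ∃ (IsSupremum _≤_ (λ x → ∃ λ n → x ≈ u n))
    sup = complete (λ x → ∃ λ n → x ≈ u n) (u 0 , 0 , refl)
      (b , λ { x (n , x≈uₙ) → ≤-respˡ (sym x≈uₙ) (bounded n) })
    s = proj₁ sup
    upper : ∀ n → u n ≤ s
    upper n = proj₁ (proj₂ sup) (u n) (n , refl)
    converge : ∀ δ → 0# < δ → ∃ λ N → ∀ m → N ℕ.≤ m → (s - δ < u m) ∧ (u m < s + δ)
    converge δ 0<δ with lem {∃ λ N → s - δ < u N}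
    ... | yes (N , p) = N , λ m N≤m →
      <-≤-trans p (mono (ℕ.≤⇒≤′ N≤m)) , ≤-<-trans (upper m) (x<x+y 0<δ)
    ... | no  ¬p = ⊥-elim (<⇒≱ (x-y<x 0<δ) (proj₂ (proj₂ sup) (s - δ)
      λ { x (n , x≈uₙ) → ≤-respˡ (sym x≈uₙ) (≮⇒≥ (λ q → ¬p (n , q))) }))

  lim-spec : ∀ {a l} → a ⟶ l → a ⟶ lim a
  lim-spec {a} h = choose-spec {d = 0#} {P = a ⟶_} (_ , h)

  -- If x bounded all naturals, they would have a supremum s; since n + 1 ≤ s for every n, the
  -- smaller number s - 1 would be an upper bound too.
  archimedean : ∀ x → ∃ λ n → x ≤ fromℕ n
  archimedean x with lem {∃ λ n → x ≤ fromℕ n}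
  ... | yes p = p
  ... | no ¬p = ⊥-elim (<⇒≱ (x-y<x 0<1) (proj₂ (proj₂ sup) (s - 1#)
      λ { y (n , y≈n) → ≤-respˡ (sym y≈n) (y-x≈z≥0⇒x≤y (x≤y⇒0≤y-x (proj₁ (proj₂ sup) _ (suc n , refl)))
        ((solve 2 (λ s n → (s :- con (+ 1)) :- n := s :- (con (+ 1) :+ n)) refl s (fromℕ n)))) }))
    where
    sup : ∃ (IsSupremum _≤_ (λ y → ∃ λ n → y ≈ fromℕ n))
    sup = complete (λ y → ∃ λ n → y ≈ fromℕ n) (0# , 0 , refl)
      (x , λ { y (n , y≈n) → ≤-respˡ (sym y≈n) (≮⇒≥ (λ q → ¬p (n , proj₁ q))) })
    s = proj₁ sup

  least : (P : ℕ → Set) → ∀ n → P n → ∃ λ m → P m ∧ (∀ k → P k → m ℕ.≤ k)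
  least P zero    p = 0 , p , λ _ _ → ℕ.z≤n
  least P (suc n) p with lem {P 0}
  ... | yes p₀ = 0 , p₀ , λ _ _ → ℕ.z≤n
  ... | no ¬p₀ with least (λ k → P (suc k)) n p
  ... | m , q , h = suc m , q , λ { zero r → contradiction r ¬p₀ ; (suc k) r → ℕ.s≤s (h k r) }

  ≤⌈⌉ : ∀ x → x ≤ fromℕ ⌈ x ⌉
  ≤⌈⌉ x = proj₁ (choose-spec {d = 0} {P = λ m → (x ≤ fromℕ m) ∧ (∀ k → x ≤ fromℕ k → m ℕ.≤ k)}
    (least (λ m → x ≤ fromℕ m) (proj₁ (archimedean x)) (proj₂ (archimedean x))))

  -- Square roots and the Cauchy–Schwarz inequality

  -- The root is the supremum s of all y ≥ 0 with y² ≤ x. If s² < x, then s + η still has square at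
  -- most x for small η; if s² > x, then s - η is already an upper bound.
  sqrt-exists : ∀ {x} → 0# ≤ x → ∃ λ y → (0# ≤ y) ∧ (y * y ≈ x)
  sqrt-exists {x} 0≤x = s , 0≤s , ≤-antisym s²≤x x≤s²
    where
    P : ℝ → Set
    P y = (0# ≤ y) ∧ (y * y ≤ x)
    sup : ∃ (IsSupremum _≤_ P)
    sup = complete P (0# , ≤-refl , ≤-respˡ (sym (zeroˡ 0#)) 0≤x)
      -- 1 + x is an upper bound because (1 + x)² - x = 1 + x + x² is nonnegative.
      (1# + x , λ { y (0≤y , y²≤x) → x²≤y²⇒x≤y (+-nonneg 0≤1 0≤x) (≤-trans y²≤x
        (y-x≈z≥0⇒x≤y (+-nonneg (+-nonneg 0≤1 0≤x) (x²≥0 x))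
          (solve 1 (λ x → (con (+ 1) :+ x) :* (con (+ 1) :+ x) :- x := (con (+ 1) :+ x) :+ x :* x) refl x))) })
    s = proj₁ sup
    0≤s : 0# ≤ s
    0≤s = proj₁ (proj₂ sup) 0# (≤-refl , ≤-respˡ (sym (zeroˡ 0#)) 0≤x)
    x-y>0 : ∀ {x y} → y < x → 0# < x - y
    x-y>0 {x} {y} (y≤x , y≉x) = x≤y⇒0≤y-x y≤x , λ e → y≉x (trans (trans (sym (+-identityʳ y)) (+-congˡ e))
      (solve 2 (λ x y → y :+ (x :- y) := x) refl x y))
    x≤s² : x ≤ s * s
    x≤s² with ≤-or-> x (s * s)
    ... | inj₁ p = p
    ... | inj₂ p =
      let η , 0<η , η≤1 , ηc≤δ = shrink (x-y>0 p) (+-nonneg 0≤1 (+-nonneg 0≤s 0≤s))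
      in ⊥-elim (<⇒≱ (x<x+y 0<η) (proj₁ (proj₂ sup) (s + η) (+-nonneg 0≤s (proj₁ 0<η) ,
        y-x≈z≥0⇒x≤y (+-nonneg (x≤y⇒0≤y-x ηc≤δ) (*-nonneg (proj₁ 0<η) (x≤y⇒0≤y-x η≤1)))
          (solve 3 (λ x s η → x :- (s :+ η) :* (s :+ η)
             := ((x :- s :* s) :- η :* (con (+ 1) :+ (s :+ s))) :+ η :* (con (+ 1) :- η)) refl x s η))))
    s²≤x : s * s ≤ x
    s²≤x with ≤-or-> (s * s) x
    ... | inj₁ p = p
    ... | inj₂ p =
      let η , 0<η , _ , ηc≤δ = shrink (x-y>0 p) (+-nonneg 0≤s 0≤s)
          0<s : 0# < s
          0<s = 0≤s , λ e → <⇒≱ p (≤-respˡ (sym (trans (*-congʳ (sym e)) (zeroˡ s))) 0≤x)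
          -- Uses 2 s (s - η) = (s² - x - 2 η s) + x + s², a sum of nonnegative terms.
          0≤s-η : 0# ≤ s - η
          0≤s-η = *-cancelˡ-≤ 0<s (≤-respˡ (sym (zeroʳ s)) (x+x≥0⇒x≥0 (≤-respʳ
            (solve 3 (λ x s η → (((s :* s :- x) :- η :* (s :+ s)) :+ x) :+ s :* s
               := s :* (s :- η) :+ s :* (s :- η)) refl x s η)
            (+-nonneg (+-nonneg (x≤y⇒0≤y-x ηc≤δ) 0≤x) (x²≥0 s)))))
      in ⊥-elim (<⇒≱ (x-y<x 0<η) (proj₂ (proj₂ sup) (s - η) λ { y (_ , y²≤x) →
        x²≤y²⇒x≤y 0≤s-η (≤-trans y²≤x (y-x≈z≥0⇒x≤y (+-nonneg (x≤y⇒0≤y-x ηc≤δ) (x²≥0 η))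
          (solve 3 (λ x s η → (s :- η) :* (s :- η) :- x
             := ((s :* s :- x) :- η :* (s :+ s)) :+ η :* η) refl x s η))) }))

  sqrt-spec : ∀ {x} → 0# ≤ x → (0# ≤ sqrt x) ∧ (sqrt x * sqrt x ≈ x)
  sqrt-spec {x} 0≤x = choose-spec {d = 0#} {P = λ y → (0# ≤ y) ∧ (y * y ≈ x)} (sqrt-exists 0≤x)

  ⟨⟩-nonneg : ∀ {d} (x : Fin d → ℝ) → 0# ≤ ⟨ x , x ⟩
  ⟨⟩-nonneg x = sum-nonneg λ c → x²≥0 (x c)

  ∥∥≤⇒⟨⟩≤ : ∀ {d b} (x : Fin d → ℝ) → ∥ x ∥ ≤ b → ⟨ x , x ⟩ ≤ b * b
  ∥∥≤⇒⟨⟩≤ x p = let r , e = sqrt-spec (⟨⟩-nonneg x) in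
    ≤-respˡ e (*-mono-≤ r (≤-trans r p) p p)

  ⟨⟩≤⇒∥∥≤ : ∀ {d b} (x : Fin d → ℝ) → 0# ≤ b → ⟨ x , x ⟩ ≤ b * b → ∥ x ∥ ≤ b
  ⟨⟩≤⇒∥∥≤ x 0≤b p = x²≤y²⇒x≤y 0≤b (≤-respˡ (sym (proj₂ (sqrt-spec (⟨⟩-nonneg x)))) p)

  sum-*-sum : ∀ {m n} (f : Fin m → ℝ) (g : Fin n → ℝ) →
              sum f * sum g ≈ sum (λ i → sum (λ j → f i * g j))
  sum-*-sum f g = trans (*-distribʳ-sum (sum g) f) (sum-cong (λ i → *-distribˡ-sum (f i) g))

  sum₂-distrib-+ : ∀ {m n} (f g : Fin m → Fin n → ℝ) →
                   sum (λ i → sum (λ j → f i j + g i j)) ≈ sum (λ i → sum (f i)) + sum (λ i → sum (g i))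
  sum₂-distrib-+ f g = trans (sum-cong λ i → sum-distrib-+ (f i) (g i))
    (sum-distrib-+ (λ i → sum (f i)) (λ i → sum (g i)))

  sum₂-distrib-- : ∀ {m n} (f g : Fin m → Fin n → ℝ) →
                   sum (λ i → sum (λ j → f i j - g i j)) ≈ sum (λ i → sum (f i)) - sum (λ i → sum (g i))
  sum₂-distrib-- f g = trans (sum-cong λ i → sum-distrib-- (f i) (g i))
    (sum-distrib-- (λ i → sum (f i)) (λ i → sum (g i)))

  -- Lagrange's identity: twice the defect is Σᵢⱼ wᵢ wⱼ (xᵢ yⱼ − xⱼ yᵢ)².
  cauchy-schwarz : ∀ {n} (w x y : Fin n → ℝ) → (∀ i → 0# ≤ w i) →
                   sum (λ i → w i * (x i * y i)) * sum (λ i → w i * (x i * y i))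
                   ≤ sum (λ i → w i * (x i * x i)) * sum (λ i → w i * (y i * y i))
  cauchy-schwarz w x y 0≤w = 0≤y-x⇒x≤y (x+x≥0⇒x≥0 (≤-respʳ lagrange
    (sum-nonneg λ i → sum-nonneg λ j → *-nonneg (*-nonneg (0≤w i) (0≤w j)) (x²≥0 _))))
    where
    open ≈-Reasoning
    xᵢ² yᵢ² z : Fin _ → ℝ
    xᵢ² i = w i * (x i * x i)
    yᵢ² i = w i * (y i * y i)
    z i = w i * (x i * y i)
    X = sum xᵢ²
    Y = sum yᵢ²
    Z = sum z
    lagrange : sum (λ i → sum (λ j → (w i * w j) * ((x i * y j - x j * y i) * (x i * y j - x j * y i))))
               ≈ (X * Y - Z * Z) + (X * Y - Z * Z)
    lagrange = begin
      _ ≈⟨ sum-cong (λ i → sum-cong (λ j →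
             solve 6 (λ a b p q r s → (a :* b) :* ((p :* s :- q :* r) :* (p :* s :- q :* r))
               := ((a :* (p :* p)) :* (b :* (s :* s)) :- (a :* (p :* r)) :* (b :* (q :* s)))
                  :+ ((a :* (r :* r)) :* (b :* (q :* q)) :- (a :* (p :* r)) :* (b :* (q :* s))))
               refl (w i) (w j) (x i) (x j) (y i) (y j))) ⟩
      sum (λ i → sum (λ j → (xᵢ² i * yᵢ² j - z i * z j) + (yᵢ² i * xᵢ² j - z i * z j)))
        ≈⟨ sum₂-distrib-+ (λ i j → xᵢ² i * yᵢ² j - z i * z j) (λ i j → yᵢ² i * xᵢ² j - z i * z j) ⟩
      sum (λ i → sum (λ j → xᵢ² i * yᵢ² j - z i * z j)) + sum (λ i → sum (λ j → yᵢ² i * xᵢ² j - z i * z j))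
        ≈⟨ +-cong (sum₂-distrib-- (λ i j → xᵢ² i * yᵢ² j) (λ i j → z i * z j))
                  (sum₂-distrib-- (λ i j → yᵢ² i * xᵢ² j) (λ i j → z i * z j)) ⟩
      _ ≈⟨ +-cong (+-cong (sum-*-sum xᵢ² yᵢ²) (-‿cong (sum-*-sum z z)))
                  (+-cong (sum-*-sum yᵢ² xᵢ²) (-‿cong (sum-*-sum z z))) ⟨
      (X * Y - Z * Z) + (Y * X - Z * Z)
        ≈⟨ +-congˡ (+-congʳ (*-comm Y X)) ⟩
      (X * Y - Z * Z) + (X * Y - Z * Z) ∎

  jensen-square : ∀ {n} (w y : Fin n → ℝ) → (∀ i → 0# ≤ w i) →
                  sum (λ i → w i * y i) * sum (λ i → w i * y i)
                  ≤ sum w * sum (λ i → w i * (y i * y i))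
  jensen-square w y 0≤w = ≤-respˡ (*-cong e e)
    (≤-respʳ (*-congʳ (sum-cong λ i → solve 1 (λ w → w :* (con (+ 1) :* con (+ 1)) := w) refl (w i)))
      (cauchy-schwarz w (λ _ → 1#) y 0≤w))
    where
    e : sum (λ i → w i * (1# * y i)) ≈ sum (λ i → w i * y i)
    e = sum-cong λ i → *-congˡ (*-identityˡ (y i))

  cauchy-schwarz-⟨⟩ : ∀ {d} (x y : Fin d → ℝ) → ⟨ x , y ⟩ * ⟨ x , y ⟩ ≤ ⟨ x , x ⟩ * ⟨ y , y ⟩
  cauchy-schwarz-⟨⟩ x y = ≤-respˡ (*-cong (e x y) (e x y)) (≤-respʳ (*-cong (e x x) (e y y))
    (cauchy-schwarz (λ _ → 1#) x y (λ _ → 0≤1)))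
    where
    e : ∀ x y → sum (λ i → 1# * (x i * y i)) ≈ ⟨ x , y ⟩
    e x y = sum-cong λ i → *-identityˡ (x i * y i)

  -- The exponential function

  open import Algebra.Properties.CommutativeSemiring.Binomial commutativeSemiring
    using () renaming (theorem to binomial-theorem)
  open import Algebra.Properties.Semiring.Mult semiring
    using (×-congʳ; ×-assoc-*)
  open import Algebra.Properties.CommutativeSemiring.Exp commutativeSemiring
    using (^-congˡ; ^-distrib-*)

  ∑<-mono : ∀ {M N f} → (∀ j → 0# ≤ f j) → M ℕ.≤′ N → ∑< M f ≤ ∑< N f
  ∑<-mono p ℕ.≤′-refl = ≤-refl
  ∑<-mono {M} {suc N} {f} p (ℕ.≤′-step q) = ≤-trans (∑<-mono p q)
    (y-x≈z≥0⇒x≤y (p N) (trans (+-congʳ (∑<-suc N f))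
      (solve 2 (λ x y → (x :+ y) :- x := y) refl (∑< N f) (f N))))

  ^-nonneg : ∀ {x} → 0# ≤ x → ∀ n → 0# ≤ x ^ n
  ^-nonneg p zero    = 0≤1
  ^-nonneg p (suc n) = *-nonneg p (^-nonneg p n)

  !-pos : ∀ n → 0# < fromℕ (n !)
  !-pos n = fromℕ-pos (ℕ.1≤n! n)

  expTerm : ℝ → ℕ → ℝ
  expTerm x j = x ^ j / fromℕ (j !)

  expSum : ℕ → ℝ → ℝ
  expSum N x = ∑< N (expTerm x)

  !-*-expTerm : ∀ x j → fromℕ (j !) * expTerm x j ≈ x ^ j
  !-*-expTerm x j = /-*-cancel (0<⇒≉0 (!-pos j))

  expTerm-zero : ∀ x → expTerm x 0 ≈ 1#
  expTerm-zero x = trans (sym (trans (*-congʳ (+-identityʳ 1#)) (*-identityˡ _))) (!-*-expTerm x 0)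

  expTerm-suc : ∀ x j → fromℕ (suc j) * expTerm x (suc j) ≈ x * expTerm x j
  expTerm-suc x j = *-cancelˡ (0<⇒≉0 (!-pos j)) (begin
    fromℕ (j !) * (fromℕ (suc j) * expTerm x (suc j))
      ≈⟨ solve 3 (λ a b c → a :* (b :* c) := (b :* a) :* c) refl (fromℕ (j !)) (fromℕ (suc j)) (expTerm x (suc j)) ⟩
    (fromℕ (suc j) * fromℕ (j !)) * expTerm x (suc j)
      ≈⟨ *-congʳ (fromℕ-* (suc j) (j !)) ⟨
    fromℕ (suc j !) * expTerm x (suc j)
      ≈⟨ !-*-expTerm x (suc j) ⟩
    x * x ^ j
      ≈⟨ *-congˡ (!-*-expTerm x j) ⟨
    x * (fromℕ (j !) * expTerm x j)
      ≈⟨ solve 3 (λ a b c → a :* (b :* c) := b :* (a :* c)) refl x (fromℕ (j !)) (expTerm x j) ⟩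
    fromℕ (j !) * (x * expTerm x j) ∎)
    where open ≈-Reasoning

  expTerm-cong : ∀ {x y} → x ≈ y → ∀ j → expTerm x j ≈ expTerm y j
  expTerm-cong x≈y j = *-congʳ (^-congˡ j x≈y)

  expTerm-nonneg : ∀ {x} → 0# ≤ x → ∀ j → 0# ≤ expTerm x j
  expTerm-nonneg p j = *-nonneg (^-nonneg p j) (proj₁ (⁻¹-pos (!-pos j)))

  expTerm-* : ∀ x y j → expTerm (x * y) j ≈ expTerm x j * y ^ j
  expTerm-* x y j = trans (*-congʳ (^-distrib-* x y j))
    (solve 3 (λ a b c → (a :* b) :* c := (a :* c) :* b) refl (x ^ j) (y ^ j) (fromℕ (j !) ⁻¹))

  expTerm-within : ∀ {x b} → Within x b → ∀ j → Within (expTerm x j) (expTerm b j)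
  expTerm-within {x} {b} p j = within-* (pow j) (nonneg⇒within (proj₁ (⁻¹-pos (!-pos j))))
    where
    pow : ∀ j → Within (x ^ j) (b ^ j)
    pow zero    = nonneg⇒within 0≤1
    pow (suc j) = within-* p (pow j)

  expSum-suc : ∀ N x → expSum (suc N) x ≈ expSum N x + expTerm x N
  expSum-suc N x = ∑<-suc N (expTerm x)

  expSum-nonneg : ∀ {x} → 0# ≤ x → ∀ N → 0# ≤ expSum N x
  expSum-nonneg 0≤x N = sum-nonneg {N} λ j → expTerm-nonneg 0≤x (toℕ j)

  expSum-mono : ∀ {x M N} → 0# ≤ x → M ℕ.≤ N → expSum M x ≤ expSum N x
  expSum-mono 0≤x le = ∑<-mono (expTerm-nonneg 0≤x) (ℕ.≤⇒≤′ le)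

  -- Past twice the argument the terms at least halve at each step, so
  -- expSum N x + 2 expTerm x N is then nonincreasing in N.
  expSum-bounded : ∀ {x} → 0# ≤ x → ∃ λ b → ∀ N → expSum N x ≤ b
  expSum-bounded {x} 0≤x = majorant K , λ N →
    ≤-trans (expSum-mono 0≤x (ℕ.m≤n+m N K)) (≤-trans
      (y-x≈z≥0⇒x≤y (+-nonneg (t≥0 (K ℕ.+ N)) (t≥0 (K ℕ.+ N)))
        (solve 2 (λ s t → (s :+ (t :+ t)) :- s := t :+ t) refl (expSum (K ℕ.+ N) x) (expTerm x (K ℕ.+ N))))
      (decreasing N))
    where
    t≥0 = expTerm-nonneg 0≤x
    majorant : ℕ → ℝ
    majorant N = expSum N x + (expTerm x N + expTerm x N)
    K = proj₁ (archimedean (x + x))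
    halving : ∀ N → K ℕ.≤ N → expTerm x (suc N) + expTerm x (suc N) ≤ expTerm x N
    halving N K≤N = *-cancelˡ-≤ (fromℕ-pos {suc N} (ℕ.s≤s ℕ.z≤n)) (begin
      fromℕ (suc N) * (expTerm x (suc N) + expTerm x (suc N))
        ≈⟨ solve 2 (λ a t → a :* (t :+ t) := a :* t :+ a :* t) refl (fromℕ (suc N)) (expTerm x (suc N)) ⟩
      fromℕ (suc N) * expTerm x (suc N) + fromℕ (suc N) * expTerm x (suc N)
        ≈⟨ +-cong (expTerm-suc x N) (expTerm-suc x N) ⟩
      x * expTerm x N + x * expTerm x N
        ≈⟨ solve 2 (λ x t → x :* t :+ x :* t := (x :+ x) :* t) refl x (expTerm x N) ⟩
      (x + x) * expTerm x N
        ≤⟨ *-monoʳ-≤ (t≥0 N) (≤-trans (proj₂ (archimedean (x + x))) (fromℕ-mono-≤ (ℕ.m≤n⇒m≤1+n K≤N))) ⟩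
      fromℕ (suc N) * expTerm x N ∎)
      where open ≤-Reasoning
    step : ∀ N → K ℕ.≤ N → majorant (suc N) ≤ majorant N
    step N K≤N = y-x≈z≥0⇒x≤y (x≤y⇒0≤y-x (halving N K≤N)) (trans (+-congˡ (-‿cong (+-congʳ (expSum-suc N x))))
      (solve 3 (λ s t u → (s :+ (t :+ t)) :- ((s :+ t) :+ (u :+ u)) := t :- (u :+ u)) refl
        (expSum N x) (expTerm x N) (expTerm x (suc N))))
    decreasing : ∀ N → majorant (K ℕ.+ N) ≤ majorant K
    decreasing zero    = ≤-reflexive (reflexive (≡.cong majorant (ℕ.+-identityʳ K)))
    decreasing (suc N) = ≤-trans (≤-reflexive (reflexive (≡.cong majorant (ℕ.+-suc K N))))
      (≤-trans (step (K ℕ.+ N) (ℕ.m≤m+n K N)) (decreasing N))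

  expSum-within : ∀ {x b} → Within x b → ∀ N → Within (expSum N x) (expSum N b)
  expSum-within p N = within-sum {N} λ j → expTerm-within p (toℕ j)

  -- If |x| ≤ b, then expSum N x + expSum N b and expSum N b are nondecreasing in N.
  expSum-converges : ∀ x → ∃ ((λ N → expSum N x) ⟶_)
  expSum-converges x =
    let b , 0≤b , x≤b = within-bound x
        B , bounded = expSum-bounded 0≤b
        l , l-lim = monotone-convergence {λ N → expSum N b}
          (λ N → expSum-mono 0≤b (ℕ.n≤1+n N)) bounded
        m , m-lim = monotone-convergence {λ N → expSum N x + expSum N b} {B + B}
          (λ N → y-x≈z≥0⇒x≤y (x≤y⇒0≤y-x (proj₁ (expTerm-within x≤b N)))
            (trans (+-congʳ (+-cong (expSum-suc N x) (expSum-suc N b)))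
              (solve 4 (λ s t u v → ((s :+ t) :+ (u :+ v)) :- (s :+ u) := t :- :- v) refl
                (expSum N x) (expTerm x N) (expSum N b) (expTerm b N))))
          (λ N → +-mono-≤ (≤-trans (proj₂ (expSum-within x≤b N)) (bounded N)) (bounded N))
    in m - l , ⟶-cong (λ N → solve 2 (λ s t → (s :+ t) :- t := s) refl (expSum N x) (expSum N b)) refl
         (⟶-- m-lim l-lim)

  expSum⟶exp : ∀ x → (λ N → expSum N x) ⟶ exp x
  expSum⟶exp x = lim-spec (proj₂ (expSum-converges x))

  exp-cong : ∀ {x y} → x ≈ y → exp x ≈ exp y
  exp-cong {x} {y} x≈y = ⟶-unique
    (⟶-cong (λ N → sum-cong {N} λ j → expTerm-cong x≈y (toℕ j)) refl (expSum⟶exp x)) (expSum⟶exp y)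

  -- The addition formula for the exponential

  nCk*k![n-k]!≡n! : ∀ {n k} → k ℕ.≤ n → (n C k) ℕ.* (k ! ℕ.* (n ℕ.∸ k) !) ≡ n !
  nCk*k![n-k]!≡n! {n} {k} k≤n = ≡.trans (≡.cong (ℕ._* (k ! ℕ.* (n ℕ.∸ k) !)) (nCk≡n!/k![n-k]! k≤n))
    (m/n*n≡m (k![n∸k]!∣n! k≤n))
    where instance _ = k ℕ.!* (n ℕ.∸ k) !≢0

  convolution : ℝ → ℝ → ℕ → ℝ
  convolution x y N = ∑< (suc N) λ i → expTerm x i * expTerm y (N ℕ.∸ i)

  -- Multiplied by N!, this is the binomial theorem, because (N choose k) k! (N - k)! = N!.
  expTerm-+ : ∀ x y N → expTerm (x + y) N ≈ convolution x y N
  expTerm-+ x y N = *-cancelˡ (0<⇒≉0 (!-pos N)) (begin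
    fromℕ (N !) * expTerm (x + y) N   ≈⟨ !-*-expTerm (x + y) N ⟩
    (x + y) ^ N                       ≈⟨ binomial-theorem N x y ⟩
    _                                 ≈⟨ sum-cong {suc N} term ⟩
    sum {suc N} (λ k → fromℕ (N !) * (expTerm x (toℕ k) * expTerm y (N ℕ.∸ toℕ k)))
      ≈⟨ *-distribˡ-sum {suc N} (fromℕ (N !)) (λ k → expTerm x (toℕ k) * expTerm y (N ℕ.∸ toℕ k)) ⟨
    fromℕ (N !) * convolution x y N   ∎)
    where
    open ≈-Reasoning
    term : ∀ (k : Fin (suc N)) → (N C toℕ k) × (x ^ toℕ k * y ^ (N ℕ.∸ toℕ k))
           ≈ fromℕ (N !) * (expTerm x (toℕ k) * expTerm y (N ℕ.∸ toℕ k))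
    term k = begin
      (N C i) × (x ^ i * y ^ j)
        ≈⟨ ×-congʳ (N C i) (*-identityˡ _) ⟨
      (N C i) × (1# * (x ^ i * y ^ j))
        ≈⟨ ×-assoc-* (N C i) 1# _ ⟨
      fromℕ (N C i) * (x ^ i * y ^ j)
        ≈⟨ *-congˡ (*-cong (!-*-expTerm x i) (!-*-expTerm y j)) ⟨
      fromℕ (N C i) * ((fromℕ (i !) * expTerm x i) * (fromℕ (j !) * expTerm y j))
        ≈⟨ solve 5 (λ a b c d e → a :* ((b :* c) :* (d :* e)) := (a :* (b :* d)) :* (c :* e)) refl
             (fromℕ (N C i)) (fromℕ (i !)) (expTerm x i) (fromℕ (j !)) (expTerm y j) ⟩
      (fromℕ (N C i) * (fromℕ (i !) * fromℕ (j !))) * (expTerm x i * expTerm y j)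
        ≈⟨ *-congʳ (trans (*-congˡ (sym (fromℕ-* (i !) (j !)))) (trans (sym (fromℕ-* (N C i) (i ! ℕ.* j !)))
             (reflexive (≡.cong fromℕ (nCk*k![n-k]!≡n! {N} {i} (Fin.toℕ≤pred[n] k)))))) ⟩
      fromℕ (N !) * (expTerm x i * expTerm y j) ∎
      where
      i = toℕ k
      j = N ℕ.∸ i

  -- The part of the double sum `expSum N x * expSum N y` over the triangle i + j < N. Raising N by
  -- one adds the antidiagonal i + j = N, which is `convolution x y N`.
  cauchyProduct : ℕ → ℝ → ℝ → ℝ
  cauchyProduct N x y = ∑< N λ i → expTerm x i * expSum (N ℕ.∸ i) y

  cauchyProduct-suc : ∀ N x y → cauchyProduct (suc N) x y ≈ cauchyProduct N x y + convolution x y N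
  cauchyProduct-suc N x y = begin
    cauchyProduct (suc N) x y
      ≈⟨ sum-cong {suc N} (λ k → term (toℕ k) (Fin.toℕ≤pred[n] k)) ⟩
    ∑< (suc N) (λ i → expTerm x i * expSum (N ℕ.∸ i) y + expTerm x i * expTerm y (N ℕ.∸ i))
      ≈⟨ sum-distrib-+ {suc N} (λ k → expTerm x (toℕ k) * expSum (N ℕ.∸ toℕ k) y)
                               (λ k → expTerm x (toℕ k) * expTerm y (N ℕ.∸ toℕ k)) ⟩
    ∑< (suc N) (λ i → expTerm x i * expSum (N ℕ.∸ i) y) + convolution x y N
      ≈⟨ +-congʳ (∑<-suc N (λ i → expTerm x i * expSum (N ℕ.∸ i) y)) ⟩
    (cauchyProduct N x y + expTerm x N * expSum (N ℕ.∸ N) y) + convolution x y N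
      -- The summand i = N carries the empty sum `expSum 0 y`, so it contributes nothing.
      ≈⟨ +-congʳ (+-congˡ (*-congˡ (reflexive (≡.cong (λ k → expSum k y) (ℕ.n∸n≡0 N))))) ⟩
    (cauchyProduct N x y + expTerm x N * 0#) + convolution x y N
      ≈⟨ solve 3 (λ a b c → (a :+ b :* con (+ 0)) :+ c := a :+ c) refl (cauchyProduct N x y) (expTerm x N) (convolution x y N) ⟩
    cauchyProduct N x y + convolution x y N ∎
    where
    open ≈-Reasoning
    term : ∀ i → i ℕ.≤ N → expTerm x i * expSum (suc N ℕ.∸ i) y
           ≈ expTerm x i * expSum (N ℕ.∸ i) y + expTerm x i * expTerm y (N ℕ.∸ i)
    term i i≤N = begin
      expTerm x i * expSum (suc N ℕ.∸ i) y
        ≈⟨ *-congˡ (reflexive (≡.cong (λ k → expSum k y) (ℕ.+-∸-assoc 1 i≤N))) ⟩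
      expTerm x i * expSum (suc (N ℕ.∸ i)) y
        ≈⟨ *-congˡ (expSum-suc (N ℕ.∸ i) y) ⟩
      expTerm x i * (expSum (N ℕ.∸ i) y + expTerm y (N ℕ.∸ i))
        ≈⟨ solve 3 (λ a b c → a :* (b :+ c) := a :* b :+ a :* c) refl (expTerm x i) (expSum (N ℕ.∸ i) y) (expTerm y (N ℕ.∸ i)) ⟩
      expTerm x i * expSum (N ℕ.∸ i) y + expTerm x i * expTerm y (N ℕ.∸ i) ∎

  expSum-+ : ∀ N x y → expSum N (x + y) ≈ cauchyProduct N x y
  expSum-+ zero    x y = refl
  expSum-+ (suc N) x y = trans (expSum-suc N (x + y))
    (trans (+-cong (expSum-+ N x y) (expTerm-+ x y N)) (sym (cauchyProduct-suc N x y)))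

  -- The square i, j < N without the triangle i + j < N: for each i the remaining j run from N - i
  -- to N - 1.
  expSum-*-defect : ∀ N x y → expSum N x * expSum N y - expSum N (x + y)
                    ≈ ∑< N (λ i → expTerm x i * (expSum N y - expSum (N ℕ.∸ i) y))
  expSum-*-defect N x y = begin
    expSum N x * expSum N y - expSum N (x + y)
      ≈⟨ +-cong (*-distribʳ-sum {N} (expSum N y) (λ k → expTerm x (toℕ k))) (-‿cong (expSum-+ N x y)) ⟩
    ∑< N (λ i → expTerm x i * expSum N y) - cauchyProduct N x y
      ≈⟨ sum-distrib-- {N} (λ k → expTerm x (toℕ k) * expSum N y) (λ k → expTerm x (toℕ k) * expSum (N ℕ.∸ toℕ k) y) ⟨
    ∑< N (λ i → expTerm x i * expSum N y - expTerm x i * expSum (N ℕ.∸ i) y)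
      ≈⟨ sum-cong {N} (λ k → solve 3 (λ a b c → a :* b :- a :* c := a :* (b :- c)) refl
           (expTerm x (toℕ k)) (expSum N y) (expSum (N ℕ.∸ toℕ k) y)) ⟩
    ∑< N (λ i → expTerm x i * (expSum N y - expSum (N ℕ.∸ i) y)) ∎
    where open ≈-Reasoning

  expSum-tail-within : ∀ {x b M N} → Within x b → M ℕ.≤′ N →
                       Within (expSum N x - expSum M x) (expSum N b - expSum M b)
  expSum-tail-within {x} {b} {M} p ℕ.≤′-refl =
    within-resp (sym (-‿inverseʳ (expSum M x))) (sym (-‿inverseʳ (expSum M b))) (nonneg⇒within ≤-refl)
  expSum-tail-within {x} {b} {M} {suc N} p (ℕ.≤′-step q) = within-resp (e x) (e b)
    (within-+ (expSum-tail-within p q) (expTerm-within p N))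
    where
    e : ∀ x → (expSum N x - expSum M x) + expTerm x N ≈ expSum (suc N) x - expSum M x
    e x = trans (solve 3 (λ a b c → (a :- b) :+ c := (a :+ c) :- b) refl (expSum N x) (expSum M x) (expTerm x N))
      (+-congʳ (sym (expSum-suc N x)))

  -- The defect is a sum of products of terms, each dominated by the same product at the bounds b
  -- and c. A defect that vanishes in the limit at nonnegative arguments therefore vanishes at all
  -- arguments.
  expSum-*-defect-within : ∀ {x y b c} → Within x b → Within y c → ∀ N →
    Within (expSum N x * expSum N y - expSum N (x + y)) (expSum N b * expSum N c - expSum N (b + c))
  expSum-*-defect-within {x} {y} {b} {c} p q N =
    within-resp (sym (expSum-*-defect N x y)) (sym (expSum-*-defect N b c))
      (within-sum {N} λ k → within-* (expTerm-within p (toℕ k))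
        (expSum-tail-within q (ℕ.≤⇒≤′ (ℕ.m∸n≤m N (toℕ k)))))

  within⇒nonneg : ∀ {x b} → Within x b → 0# ≤ b
  within⇒nonneg {x} {b} (p , q) = x+x≥0⇒x≥0 (≤-respʳ (solve 1 (λ b → b :- :- b := b :+ b) refl b)
    (x≤y⇒0≤y-x (≤-trans p q)))

  -- For nonnegative terms the square i, j < N lies in the triangle i + j < 2N. This is the upper
  -- half of the sandwich behind `exp-+-nonneg`; the lower half is that the square contains the
  -- triangle i + j < N.
  expSum-*-≤ : ∀ {x y} → 0# ≤ x → 0# ≤ y → ∀ N → expSum N x * expSum N y ≤ expSum (N ℕ.+ N) (x + y)
  expSum-*-≤ {x} {y} 0≤x 0≤y N = begin
    expSum N x * expSum N y
      ≈⟨ *-distribʳ-sum {N} (expSum N y) (λ k → expTerm x (toℕ k)) ⟩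
    ∑< N (λ i → expTerm x i * expSum N y)
      ≤⟨ sum-mono {N} (λ k → *-monoˡ-≤ (expTerm-nonneg 0≤x (toℕ k)) (expSum-mono 0≤y (index k))) ⟩
    ∑< N (λ i → expTerm x i * expSum (N ℕ.+ N ℕ.∸ i) y)
      ≤⟨ ∑<-mono {N} {N ℕ.+ N} (λ i → *-nonneg (expTerm-nonneg 0≤x i) (expSum-nonneg 0≤y (N ℕ.+ N ℕ.∸ i))) (ℕ.≤⇒≤′ (ℕ.m≤m+n N N)) ⟩
    cauchyProduct (N ℕ.+ N) x y
      ≈⟨ expSum-+ (N ℕ.+ N) x y ⟨
    expSum (N ℕ.+ N) (x + y) ∎
    where
    open ≤-Reasoning
    index : ∀ (k : Fin N) → N ℕ.≤ N ℕ.+ N ℕ.∸ toℕ k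
    index k = ℕ.≤-trans (ℕ.m≤m+n N (N ℕ.∸ toℕ k)) (ℕ.≤-reflexive (≡.sym (ℕ.+-∸-assoc N (ℕ.<⇒≤ (Fin.toℕ<n k)))))

  ⟶-shift : ∀ {a l} k → a ⟶ l → (λ i → a (k ℕ.+ i)) ⟶ l
  ⟶-shift k h δ 0<δ = let N , p = h δ 0<δ in N , λ m N≤m → p (k ℕ.+ m) (ℕ.≤-trans N≤m (ℕ.m≤n+m m k))

  expSum≤exp : ∀ {x} → 0# ≤ x → ∀ N → expSum N x ≤ exp x
  expSum≤exp {x} 0≤x N = ⟶-mono-≤ (λ i → expSum-mono 0≤x (ℕ.m≤m+n N i))
    (⟶-const (expSum N x)) (⟶-shift N (expSum⟶exp x))

  exp-+-nonneg : ∀ {x y} → 0# ≤ x → 0# ≤ y → exp x * exp y ≈ exp (x + y)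
  exp-+-nonneg {x} {y} 0≤x 0≤y = ≤-antisym
    (⟶-mono-≤ (λ N → ≤-trans (expSum-*-≤ 0≤x 0≤y N) (expSum≤exp (+-nonneg 0≤x 0≤y) (N ℕ.+ N)))
      (⟶-* (expSum⟶exp x) (expSum⟶exp y)) (⟶-const _))
    (⟶-mono-≤ (λ N → 0≤y-x⇒x≤y (within⇒nonneg (expSum-*-defect-within (nonneg⇒within 0≤x) (nonneg⇒within 0≤y) N)))
      (expSum⟶exp (x + y)) (⟶-* (expSum⟶exp x) (expSum⟶exp y)))

  -- The defect at (x, y) is squeezed by the defect at nonnegative bounds (b, c), which tends to exp
  -- b exp c - exp (b + c) = 0.
  exp-+ : ∀ x y → exp x * exp y ≈ exp (x + y)
  exp-+ x y =
    let b , 0≤b , x≤b = within-bound x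
        c , 0≤c , y≤c = within-bound y
    in ⟶-unique (⟶-* (expSum⟶exp x) (expSum⟶exp y))
         (⟶-squeeze (expSum-*-defect-within x≤b y≤c)
           (⟶-cong (λ _ → refl) (trans (+-congʳ (exp-+-nonneg 0≤b 0≤c)) (-‿inverseʳ (exp (b + c))))
             (⟶-- (⟶-* (expSum⟶exp b) (expSum⟶exp c)) (expSum⟶exp (b + c))))
           (expSum⟶exp (x + y)))

  -- Positivity, lower bounds and monotonicity of the exponential

  expTerm-one : ∀ x → expTerm x 1 ≈ x
  expTerm-one x = trans (trans (sym (*-identityˡ _)) (*-congʳ (sym (+-identityʳ 1#))))
    (trans (expTerm-suc x 0) (trans (*-congˡ (expTerm-zero x)) (trans (*-comm x 1#) (*-identityˡ x))))

  1+x≤exp-nonneg : ∀ {x} → 0# ≤ x → 1# + x ≤ exp x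
  1+x≤exp-nonneg {x} 0≤x = ≤-respˡ (+-cong (expTerm-zero x) (trans (+-identityʳ _) (expTerm-one x)))
    (expSum≤exp 0≤x 2)

  0<exp-nonneg : ∀ {x} → 0# ≤ x → 0# < exp x
  0<exp-nonneg 0≤x = <-≤-trans (+-pos-nonneg 0<1 0≤x) (1+x≤exp-nonneg 0≤x)

  -- The addition formula makes exp 0 idempotent, and a positive idempotent of a field is 1.
  exp-0 : exp 0# ≈ 1#
  exp-0 = *-cancelˡ (0<⇒≉0 (0<exp-nonneg ≤-refl)) (trans (exp-+ 0# 0#)
    (trans (exp-cong (+-identityˡ 0#)) (sym (trans (*-comm _ 1#) (*-identityˡ _)))))

  exp-neg-* : ∀ x → exp x * exp (- x) ≈ 1#
  exp-neg-* x = trans (exp-+ x (- x)) (trans (exp-cong (-‿inverseʳ x)) exp-0)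

  -- (1 − y) eʸ telescopes into 1 + Σⱼ (yʲ⁺¹/(j+1)! − y · yʲ/j!), whose summands are nonpositive.
  [1-y]*exp≤1 : ∀ {y} → 0# ≤ y → (1# - y) * exp y ≤ 1#
  [1-y]*exp≤1 {y} 0≤y = ⟶-mono-≤
    (λ N → ≤-trans (y-x≈z≥0⇒x≤y (*-nonneg 0≤y (t≥0 N))
      (solve 2 (λ a b → (a :+ b) :- a := b) refl ((1# - y) * expSum (suc N) y) (y * expTerm y N))) (bound N))
    (⟶-* (⟶-const (1# - y)) (⟶-shift 1 (expSum⟶exp y))) (⟶-const 1#)
    where
    t≥0 = expTerm-nonneg 0≤y
    open ≤-Reasoning
    bound : ∀ N → (1# - y) * expSum (suc N) y + y * expTerm y N ≤ 1#
    bound zero = ≤-reflexive (trans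
      (solve 2 (λ y t → (con (+ 1) :- y) :* (t :+ con (+ 0)) :+ y :* t := t) refl y (expTerm y 0)) (expTerm-zero y))
    bound (suc N) = begin
      (1# - y) * expSum (suc (suc N)) y + y * expTerm y (suc N)
        ≈⟨ +-congʳ (*-congˡ (expSum-suc (suc N) y)) ⟩
      (1# - y) * (expSum (suc N) y + expTerm y (suc N)) + y * expTerm y (suc N)
        ≈⟨ solve 3 (λ y s t → (con (+ 1) :- y) :* (s :+ t) :+ y :* t := (con (+ 1) :- y) :* s :+ t) refl
             y (expSum (suc N) y) (expTerm y (suc N)) ⟩
      (1# - y) * expSum (suc N) y + expTerm y (suc N)
        ≤⟨ +-mono-≤ ≤-refl (y-x≈z≥0⇒x≤y (*-nonneg (fromℕ-nonneg N) (t≥0 (suc N)))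
             (trans (+-congʳ (sym (expTerm-suc y N)))
               (solve 2 (λ n t → (con (+ 1) :+ n) :* t :- t := n :* t) refl (fromℕ N) (expTerm y (suc N))))) ⟩
      (1# - y) * expSum (suc N) y + y * expTerm y N
        ≤⟨ bound N ⟩
      1# ∎

  exp-pos : ∀ x → 0# < exp x
  exp-pos x with ≤-total 0# x
  ... | inj₁ p = 0<exp-nonneg p
  ... | inj₂ p with ≤-or-> (exp x) 0#
  ...   | inj₂ q = q
  ...   | inj₁ q = ⊥-elim (<⇒≱ 0<1 (≤-respˡ (exp-neg-* x) (≤-respʳ (zeroˡ _)
            (*-monoʳ-≤ (proj₁ (0<exp-nonneg (≤-respʳ (+-identityˡ (- x)) (x≤y⇒0≤y-x p)))) q))))

  -- For x ≤ 0 the series has mixed signs. Multiplying by exp (-x) turns the claim into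
  -- `[1-y]*exp≤1` at y = -x.
  1+x≤exp : ∀ x → 1# + x ≤ exp x
  1+x≤exp x with ≤-total 0# x
  ... | inj₁ p = 1+x≤exp-nonneg p
  ... | inj₂ p = *-cancelˡ-≤ (exp-pos (- x)) (≤-respˡ
    (solve 2 (λ x e → (con (+ 1) :- :- x) :* e := e :* (con (+ 1) :+ x)) refl x (exp (- x)))
    (≤-respʳ (trans (sym (exp-neg-* x)) (*-comm _ _))
      ([1-y]*exp≤1 (≤-respʳ (+-identityˡ (- x)) (x≤y⇒0≤y-x p)))))

  exp-mono : ∀ {x y} → x ≤ y → exp x ≤ exp y
  exp-mono {x} {y} x≤y = begin
    exp x                  ≈⟨ trans (*-comm _ _) (*-identityˡ _) ⟨
    exp x * 1#             ≤⟨ *-monoˡ-≤ (proj₁ (exp-pos x)) (≤-trans (y-x≈z≥0⇒x≤y (x≤y⇒0≤y-x x≤y)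
                                (solve 1 (λ d → (con (+ 1) :+ d) :- con (+ 1) := d) refl (y - x))) (1+x≤exp (y - x))) ⟩
    exp x * exp (y - x)    ≈⟨ exp-+ x (y - x) ⟩
    exp (x + (y - x))      ≈⟨ exp-cong (solve 2 (λ x y → x :+ (y :- x) := y) refl x y) ⟩
    exp y                  ∎
    where open ≤-Reasoning

  -- The exponential kernel

  sum₂-swap-* : ∀ {m n} (a : Fin m → ℝ) (b : Fin n → ℝ) (c : Fin m → Fin n → ℝ) →
                sum (λ i → a i * sum (λ j → b j * c i j)) ≈ sum (λ j → b j * sum (λ i → a i * c i j))
  sum₂-swap-* a b c = begin
    sum (λ i → a i * sum (λ j → b j * c i j))
      ≈⟨ sum-cong (λ i → *-distribˡ-sum (a i) (λ j → b j * c i j)) ⟩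
    sum (λ i → sum (λ j → a i * (b j * c i j)))
      ≈⟨ ∑-comm (λ i j → a i * (b j * c i j)) ⟩
    sum (λ j → sum (λ i → a i * (b j * c i j)))
      ≈⟨ sum-cong (λ j → sum-cong (λ i → solve 3 (λ a b c → a :* (b :* c) := b :* (a :* c)) refl (a i) (b j) (c i j))) ⟩
    sum (λ j → sum (λ i → b j * (a i * c i j)))
      ≈⟨ sum-cong (λ j → *-distribˡ-sum (b j) (λ i → a i * c i j)) ⟨
    sum (λ j → b j * sum (λ i → a i * c i j)) ∎
    where open ≈-Reasoning

  quadraticForm : ∀ {n} → (Fin n → Fin n → ℝ) → (Fin n → ℝ) → ℝ
  quadraticForm H f = sum λ i → sum λ l → (f i * f l) * H i l

  module _ {n d : ℕ} (k : Fin n → Fin d → ℝ) {p : Fin d → ℝ} (p≤1 : ⟨ p , p ⟩ ≤ 1#) where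

    -- ⟨p, k⟩ʲ is the inner product of the j-fold tensor powers of p and k; the
    -- induction on j peels off one tensor factor, by Cauchy–Schwarz in it.
    power-kernel-≤ : ∀ j (f : Fin n → ℝ) →
      sum (λ i → f i * ⟨ p , k i ⟩ ^ j) * sum (λ i → f i * ⟨ p , k i ⟩ ^ j)
      ≤ quadraticForm (λ i l → ⟨ k i , k l ⟩ ^ j) f
    power-kernel-≤ zero f = ≤-reflexive (trans
      (*-cong (sum-cong λ i → trans (*-comm (f i) 1#) (*-identityˡ (f i)))
              (sum-cong λ i → trans (*-comm (f i) 1#) (*-identityˡ (f i))))
      (trans (sum-*-sum f f) (sum-cong λ i → sum-cong λ l →
        sym (trans (*-comm (f i * f l) 1#) (*-identityˡ (f i * f l))))))
    power-kernel-≤ (suc j) f = begin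
      sum (λ i → f i * (⟨ p , k i ⟩ * ⟨ p , k i ⟩ ^ j)) * sum (λ i → f i * (⟨ p , k i ⟩ * ⟨ p , k i ⟩ ^ j))
        ≈⟨ *-cong peel peel ⟩
      ⟨ p , y ⟩ * ⟨ p , y ⟩
        ≤⟨ cauchy-schwarz-⟨⟩ p y ⟩
      ⟨ p , p ⟩ * ⟨ y , y ⟩
        ≤⟨ *-monoʳ-≤ (⟨⟩-nonneg y) p≤1 ⟩
      1# * ⟨ y , y ⟩
        ≈⟨ *-identityˡ ⟨ y , y ⟩ ⟩
      ⟨ y , y ⟩
        ≤⟨ sum-mono (λ c → power-kernel-≤ j (λ i → f i * k i c)) ⟩
      sum (λ c → sum (λ i → sum (λ l → ((f i * k i c) * (f l * k l c)) * K i l ^ j)))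
        ≈⟨ ∑-comm (λ c i → sum (λ l → ((f i * k i c) * (f l * k l c)) * K i l ^ j)) ⟩
      sum (λ i → sum (λ c → sum (λ l → ((f i * k i c) * (f l * k l c)) * K i l ^ j)))
        ≈⟨ sum-cong (λ i → ∑-comm (λ c l → ((f i * k i c) * (f l * k l c)) * K i l ^ j)) ⟩
      sum (λ i → sum (λ l → sum (λ c → ((f i * k i c) * (f l * k l c)) * K i l ^ j)))
        ≈⟨ sum-cong (λ i → sum-cong (λ l → unpeel i l)) ⟩
      quadraticForm (λ i l → K i l ^ suc j) f ∎
      where
      open ≤-Reasoning
      K : Fin n → Fin n → ℝ
      K i l = ⟨ k i , k l ⟩
      y : Fin d → ℝ
      y c = sum λ i → (f i * k i c) * ⟨ p , k i ⟩ ^ j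
      peel : sum (λ i → f i * (⟨ p , k i ⟩ * ⟨ p , k i ⟩ ^ j)) ≈ ⟨ p , y ⟩
      peel = trans (sum-cong λ i → solve 3 (λ a b c → a :* (b :* c) := (a :* c) :* b) refl
                     (f i) ⟨ p , k i ⟩ (⟨ p , k i ⟩ ^ j))
        (trans (sum₂-swap-* (λ i → f i * ⟨ p , k i ⟩ ^ j) p k)
          (sum-cong λ c → *-congˡ (sum-cong λ i → solve 3 (λ a b c → (a :* b) :* c := (a :* c) :* b) refl
             (f i) (⟨ p , k i ⟩ ^ j) (k i c))))
      unpeel : ∀ i l → sum (λ c → ((f i * k i c) * (f l * k l c)) * K i l ^ j) ≈ (f i * f l) * (K i l * K i l ^ j)
      unpeel i l = trans
        (sum-cong λ c → solve 5 (λ a b c d e → ((a :* b) :* (c :* d)) :* e := ((a :* c) :* e) :* (b :* d)) refl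
           (f i) (k i c) (f l) (k l c) (K i l ^ j))
        (trans (sym (*-distribˡ-sum ((f i * f l) * K i l ^ j) (λ c → k i c * k l c)))
          (solve 3 (λ a b c → (a :* b) :* c := a :* (c :* b)) refl (f i * f l) (K i l ^ j) (K i l)))

    module _ {ρ : ℝ} (0≤ρ : 0# ≤ ρ) (f : Fin n → ℝ) where

      -- Jensen's inequality with the weights ρ^j / j!, whose total `expSum N ρ` is the source of
      -- the factor `exp ρ`. At a fixed truncation all sums are finite and can be exchanged;
      -- `exp-kernel-≤` then takes the limit.
      expSum-kernel-≤ : ∀ N →
        sum (λ i → f i * expSum N (ρ * ⟨ p , k i ⟩)) * sum (λ i → f i * expSum N (ρ * ⟨ p , k i ⟩))
        ≤ expSum N ρ * quadraticForm (λ i l → expSum N (ρ * ⟨ k i , k l ⟩)) f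
      expSum-kernel-≤ N = begin
        sum (λ i → f i * expSum N (ρ * ⟨ p , k i ⟩)) * sum (λ i → f i * expSum N (ρ * ⟨ p , k i ⟩))
          ≈⟨ *-cong expand expand ⟩
        sum {N} (λ j → t j * y j) * sum {N} (λ j → t j * y j)
          ≤⟨ jensen-square t y t≥0 ⟩
        expSum N ρ * sum {N} (λ j → t j * (y j * y j))
          ≤⟨ *-monoˡ-≤ (expSum-nonneg 0≤ρ N) (sum-mono {N} (λ j → *-monoˡ-≤ (t≥0 j) (power-kernel-≤ (toℕ j) f))) ⟩
        expSum N ρ * sum {N} (λ j → t j * quadraticForm (λ i l → ⟨ k i , k l ⟩ ^ toℕ j) f)
          ≈⟨ *-congˡ collect ⟩
        expSum N ρ * quadraticForm (λ i l → expSum N (ρ * ⟨ k i , k l ⟩)) f ∎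
        where
        open ≤-Reasoning
        t y : Fin N → ℝ
        t j = expTerm ρ (toℕ j)
        y j = sum λ i → f i * ⟨ p , k i ⟩ ^ toℕ j
        t≥0 : ∀ j → 0# ≤ t j
        t≥0 j = expTerm-nonneg 0≤ρ (toℕ j)
        split : ∀ x → expSum N (ρ * x) ≈ sum {N} (λ j → t j * x ^ toℕ j)
        split x = sum-cong {N} λ j → expTerm-* ρ x (toℕ j)
        expand : sum (λ i → f i * expSum N (ρ * ⟨ p , k i ⟩)) ≈ sum {N} (λ j → t j * y j)
        expand = trans (sum-cong λ i → *-congˡ (split ⟨ p , k i ⟩))
          (sum₂-swap-* f t (λ i j → ⟨ p , k i ⟩ ^ toℕ j))
        collect : sum {N} (λ j → t j * quadraticForm (λ i l → ⟨ k i , k l ⟩ ^ toℕ j) f)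
                  ≈ quadraticForm (λ i l → expSum N (ρ * ⟨ k i , k l ⟩)) f
        collect = trans (sum-cong {N} λ j → *-distribˡ-sum (t j) (λ i → sum λ l → (f i * f l) * ⟨ k i , k l ⟩ ^ toℕ j))
          (trans (∑-comm (λ j i → t j * sum (λ l → (f i * f l) * ⟨ k i , k l ⟩ ^ toℕ j)))
            (sum-cong λ i → trans (sum₂-swap-* t (λ l → f i * f l) (λ j l → ⟨ k i , k l ⟩ ^ toℕ j))
              (sum-cong λ l → *-congˡ (sym (split ⟨ k i , k l ⟩)))))

      exp-kernel-≤ : sum (λ i → f i * exp (ρ * ⟨ p , k i ⟩)) * sum (λ i → f i * exp (ρ * ⟨ p , k i ⟩))
                     ≤ exp ρ * quadraticForm (λ i l → exp (ρ * ⟨ k i , k l ⟩)) f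
      exp-kernel-≤ = ⟶-mono-≤ expSum-kernel-≤ (⟶-* linear linear)
        (⟶-* (expSum⟶exp ρ) (⟶-sum λ i → ⟶-sum λ l → ⟶-* (⟶-const (f i * f l)) (expSum⟶exp (ρ * ⟨ k i , k l ⟩))))
        where
        linear = ⟶-sum λ i → ⟶-* (⟶-const (f i)) (expSum⟶exp (ρ * ⟨ p , k i ⟩))

  x²≤0⇒x≈0 : ∀ {x} → x * x ≤ 0# → x ≈ 0#
  x²≤0⇒x≈0 {x} p = ≤-antisym (x²≤y²⇒x≤y ≤-refl (≤-respʳ (sym (zeroˡ 0#)) p))
    (y-x≈z≥0⇒x≤y (x≤y⇒0≤y-x (x²≤y²⇒x≤y { - x} {0#} ≤-refl
       (≤-respˡ (solve 1 (λ x → x :* x := :- x :* :- x) refl x) (≤-respʳ (sym (zeroˡ 0#)) p))))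
      (solve 1 (λ x → x :- con (+ 0) := con (+ 0) :- :- x) refl x))

  -- Moves the radius out of the query, so that ρ appears in the series weights and the direction p
  -- has norm at most 1.
  rescale : ∀ {d ρ} (q : Fin d → ℝ) → 0# ≤ ρ → ⟨ q , q ⟩ ≤ ρ * ρ →
            ∃ λ p → (⟨ p , p ⟩ ≤ 1#) ∧ (∀ k → ρ * ⟨ p , k ⟩ ≈ ⟨ q , k ⟩)
  rescale {d} {ρ} q 0≤ρ q≤ρ with ≤-or-> ρ 0#
  -- Here ρ = 0, so q / ρ makes no sense. Cauchy-Schwarz gives ⟨q, k⟩² ≤ 0, and p = 0 serves.
  ... | inj₁ ρ≤0 = (λ _ → 0#)
      , ≤-respˡ (sym (sum-zero {d} (λ c → zeroˡ 0#))) 0≤1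
      , λ k → trans (trans (*-congˡ (sum-zero {d} (λ c → zeroˡ (k c)))) (zeroʳ ρ)) (sym (x²≤0⇒x≈0
          (≤-trans (cauchy-schwarz-⟨⟩ q k) (≤-respʳ (zeroˡ ⟨ k , k ⟩) (*-monoʳ-≤ (⟨⟩-nonneg k)
            (≤-trans q≤ρ (≤-respʳ (zeroʳ ρ) (*-monoˡ-≤ 0≤ρ ρ≤0))))))))
  ... | inj₂ 0<ρ = (λ c → ρ ⁻¹ * q c)
      , *-cancelˡ-≤ (*-pos 0<ρ 0<ρ) (≤-respˡ (sym (trans (*-congˡ p²)
          (trans (solve 3 (λ r s q → (r :* r) :* ((s :* s) :* q) := (r :* s) :* ((r :* s) :* q)) refl ρ (ρ ⁻¹) ⟨ q , q ⟩)
            (trans (*-cong e (*-congʳ e)) (solve 1 (λ q → con (+ 1) :* (con (+ 1) :* q) := q) refl ⟨ q , q ⟩)))))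
          (≤-respʳ (solve 1 (λ r → r :* r := (r :* r) :* con (+ 1)) refl ρ) q≤ρ))
      , λ k → trans (*-distribˡ-sum ρ (λ c → (ρ ⁻¹ * q c) * k c)) (sum-cong λ c →
          trans (solve 4 (λ r s q k → r :* ((s :* q) :* k) := (r :* s) :* (q :* k)) refl ρ (ρ ⁻¹) (q c) (k c))
            (trans (*-congʳ e) (*-identityˡ (q c * k c))))
    where
    e : ρ * ρ ⁻¹ ≈ 1#
    e = ⁻¹-inverse (0<⇒≉0 0<ρ)
    p² : ⟨ (λ c → ρ ⁻¹ * q c) , (λ c → ρ ⁻¹ * q c) ⟩ ≈ (ρ ⁻¹ * ρ ⁻¹) * ⟨ q , q ⟩
    p² = trans (sum-cong λ c → solve 2 (λ s q → (s :* q) :* (s :* q) := (s :* s) :* (q :* q)) refl (ρ ⁻¹) (q c))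
      (sym (*-distribˡ-sum (ρ ⁻¹ * ρ ⁻¹) (λ c → q c * q c)))

  -- Sampling without replacement

  module _ {A : Set} where

    listSum : List A → (A → ℝ) → ℝ
    listSum []       F = 0#
    listSum (x ∷ xs) F = F x + listSum xs F

    listSum-++ : ∀ xs ys F → listSum (xs ++ ys) F ≈ listSum xs F + listSum ys F
    listSum-++ []       ys F = sym (+-identityˡ _)
    listSum-++ (x ∷ xs) ys F = trans (+-congˡ (listSum-++ xs ys F))
      (solve 3 (λ a b c → a :+ (b :+ c) := (a :+ b) :+ c) refl (F x) (listSum xs F) (listSum ys F))

    listSum-cong : ∀ {xs F G} → All (λ x → F x ≈ G x) xs → listSum xs F ≈ listSum xs G
    listSum-cong []       = refl
    listSum-cong (p ∷ ps) = +-cong p (listSum-cong ps)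

    listSum-cong′ : ∀ xs {F G} → (∀ x → F x ≈ G x) → listSum xs F ≈ listSum xs G
    listSum-cong′ xs p = listSum-cong (All.universal p xs)

    listSum-mono : ∀ xs {F G} → (∀ x → F x ≤ G x) → listSum xs F ≤ listSum xs G
    listSum-mono []       p = ≤-refl
    listSum-mono (x ∷ xs) p = +-mono-≤ (p x) (listSum-mono xs p)

    listSum-distrib-+ : ∀ xs F G → listSum xs (λ x → F x + G x) ≈ listSum xs F + listSum xs G
    listSum-distrib-+ []       F G = sym (+-identityˡ 0#)
    listSum-distrib-+ (x ∷ xs) F G = trans (+-congˡ (listSum-distrib-+ xs F G))
      (solve 4 (λ a b c d → (a :+ b) :+ (c :+ d) := (a :+ c) :+ (b :+ d)) refl (F x) (G x) (listSum xs F) (listSum xs G))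

    *-distribˡ-listSum : ∀ a xs F → a * listSum xs F ≈ listSum xs (λ x → a * F x)
    *-distribˡ-listSum a []       F = zeroʳ a
    *-distribˡ-listSum a (x ∷ xs) F = trans
      (solve 3 (λ a b c → a :* (b :+ c) := a :* b :+ a :* c) refl a (F x) (listSum xs F))
      (+-congˡ (*-distribˡ-listSum a xs F))

    listSum-zero : ∀ xs → listSum xs (λ _ → 0#) ≈ 0#
    listSum-zero []       = refl
    listSum-zero (x ∷ xs) = trans (+-identityˡ _) (listSum-zero xs)

    listSum-one : ∀ xs → listSum xs (λ _ → 1#) ≈ fromℕ (length xs)
    listSum-one []       = refl
    listSum-one (x ∷ xs) = +-congˡ (listSum-one xs)

    listSum-sum-comm : ∀ {n} xs (F : A → Fin n → ℝ) →
                       listSum xs (λ x → sum (F x)) ≈ sum (λ i → listSum xs (λ x → F x i))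
    listSum-sum-comm {n} []       F = sym (sum-zero {n} (λ _ → refl))
    listSum-sum-comm     (x ∷ xs) F = trans (+-congˡ (listSum-sum-comm xs F))
      (sym (sum-distrib-+ (F x) (λ i → listSum xs (λ x → F x i))))

  listSum-map : ∀ {A B : Set} (f : A → B) xs F → listSum (List.map f xs) F ≈ listSum xs (F ∘ f)
  listSum-map f []       F = refl
  listSum-map f (x ∷ xs) F = +-congˡ (listSum-map f xs F)

  -- Subsets of a given size

  filter-map : ∀ {A B : Set} {P : Pred B 0ℓ} (P? : Decidable P) (f : A → B) xs →
               filter P? (List.map f xs) ≡ List.map f (filter (P? ∘ f) xs)
  filter-map P? f []       = ≡.refl
  filter-map P? f (x ∷ xs) with does (P? (f x))
  ... | true  = ≡.cong (f x ∷_) (filter-map P? f xs)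
  ... | false = filter-map P? f xs

  -- Pascal's rule for the lists themselves, by whether the first point is left out or taken. The
  -- counts below are inductions along this split.
  subsetsOfSize-suc : ∀ n m → subsetsOfSize (suc n) (suc m)
    ≡ List.map (outside Vec.∷_) (subsetsOfSize n (suc m)) ++ List.map (inside Vec.∷_) (subsetsOfSize n m)
  subsetsOfSize-suc n m = ≡.trans (filter-++ (λ S → ∣ S ∣ ℕ.≟ suc m) (List.map (outside Vec.∷_) (allSubsets n)) _)
    (≡.cong₂ _++_ (filter-map (λ S → ∣ S ∣ ℕ.≟ suc m) (outside Vec.∷_) (allSubsets n))
      (≡.trans (filter-map (λ S → ∣ S ∣ ℕ.≟ suc m) (inside Vec.∷_) (allSubsets n))
        (≡.cong (List.map (inside Vec.∷_))
          (filter-≐ (λ S → suc ∣ S ∣ ℕ.≟ suc m) (λ S → ∣ S ∣ ℕ.≟ m) (ℕ.suc-injective , ≡.cong suc) (allSubsets n)))))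

  subsetsOfSize-zero : ∀ n → subsetsOfSize (suc n) 0 ≡ List.map (outside Vec.∷_) (subsetsOfSize n 0)
  subsetsOfSize-zero n = ≡.trans (filter-++ (λ S → ∣ S ∣ ℕ.≟ 0) (List.map (outside Vec.∷_) (allSubsets n)) _)
    (≡.trans (≡.cong₂ _++_ (filter-map (λ S → ∣ S ∣ ℕ.≟ 0) (outside Vec.∷_) (allSubsets n))
      (≡.trans (filter-map (λ S → ∣ S ∣ ℕ.≟ 0) (inside Vec.∷_) (allSubsets n))
        (≡.cong (List.map (inside Vec.∷_))
          (filter-none (λ S → ∣ inside Vec.∷ S ∣ ℕ.≟ 0) (All.universal (λ S ()) (allSubsets n))))))
      (++-identityʳ _))

  subsetsOfSize-size : ∀ n m → All (λ S → ∣ S ∣ ≡ m) (subsetsOfSize n m)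
  subsetsOfSize-size n m = all-filter (λ S → ∣ S ∣ ℕ.≟ m) (allSubsets n)

  subsetSum : ∀ n m → (Subset n → ℝ) → ℝ
  subsetSum n m = listSum (subsetsOfSize n m)

  subsetSum-suc : ∀ n m F → subsetSum (suc n) (suc m) F
    ≈ subsetSum n (suc m) (F ∘ (outside Vec.∷_)) + subsetSum n m (F ∘ (inside Vec.∷_))
  subsetSum-suc n m F = trans (reflexive (≡.cong (λ Ω → listSum Ω F) (subsetsOfSize-suc n m)))
    (trans (listSum-++ (List.map (outside Vec.∷_) (subsetsOfSize n (suc m))) _ F)
      (+-cong (listSum-map _ (subsetsOfSize n (suc m)) F) (listSum-map _ (subsetsOfSize n m) F)))

  subsetSum-zero : ∀ n F → subsetSum (suc n) 0 F ≈ subsetSum n 0 (F ∘ (outside Vec.∷_))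
  subsetSum-zero n F = trans (reflexive (≡.cong (λ Ω → listSum Ω F) (subsetsOfSize-zero n)))
    (listSum-map _ (subsetsOfSize n 0) F)

  indicator : ∀ {n} → Subset n → Fin n → ℝ
  indicator S i = if lookup S i then 1# else 0#

  -- The binomial coefficient (n choose m) as a real number. No closed form enters below, only
  -- Pascal's rule and double counting.
  card : ℕ → ℕ → ℝ
  card n m = subsetSum n m (λ _ → 1#)

  -- The number of subsets of size m that contain a given point, and that
  -- contain two given distinct points.
  pointCount pairCount : ℕ → ℕ → ℝ
  pointCount (suc n) (suc m) = card n m
  pointCount zero    m       = 0#
  pointCount (suc n) zero    = 0#
  pairCount (suc n) (suc m) = pointCount n m
  pairCount zero    m       = 0#
  pairCount (suc n) zero    = 0#

  pointCount-pascal : ∀ n m → pointCount (suc n) (suc m) + pointCount (suc n) m ≈ card (suc n) m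
  pointCount-pascal n zero    = trans (+-identityʳ _) (sym (subsetSum-zero n (λ _ → 1#)))
  pointCount-pascal n (suc m) = sym (subsetSum-suc n m (λ _ → 1#))

  subsetSum-indicator : ∀ n m i → subsetSum n m (λ S → indicator S i) ≈ pointCount n m
  subsetSum-indicator (suc n) zero zero = trans (subsetSum-zero n _) (listSum-zero (subsetsOfSize n 0))
  subsetSum-indicator (suc (suc n)) zero (suc i) =
    trans (subsetSum-zero (suc n) _) (subsetSum-indicator (suc n) zero i)
  subsetSum-indicator (suc n) (suc m) zero = trans (subsetSum-suc n m _)
    (trans (+-congʳ (listSum-zero (subsetsOfSize n (suc m)))) (+-identityˡ (card n m)))
  subsetSum-indicator (suc (suc n)) (suc m) (suc i) = trans (subsetSum-suc (suc n) m _)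
    (trans (+-cong (subsetSum-indicator (suc n) (suc m) i) (subsetSum-indicator (suc n) m i))
      (pointCount-pascal n m))

  pairCount-pascal : ∀ n m → pairCount (suc (suc n)) (suc m) + pairCount (suc (suc n)) m ≈ pointCount (suc (suc n)) m
  pairCount-pascal n zero    = +-identityʳ 0#
  pairCount-pascal n (suc m) = pointCount-pascal n m

  -- Induction on the first point: if it is i or l, only the other index remains and
  -- `subsetSum-indicator` applies; if it is neither, Pascal's rule does.
  subsetSum-pair : ∀ n m i l → i ≢ l → subsetSum n m (λ S → indicator S i * indicator S l) ≈ pairCount n m
  subsetSum-pair (suc n) m zero zero p = contradiction ≡.refl p
  subsetSum-pair (suc n) zero zero (suc l) p = trans (subsetSum-zero n _)
    (trans (listSum-cong′ (subsetsOfSize n 0) (λ S → zeroˡ _)) (listSum-zero (subsetsOfSize n 0)))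
  subsetSum-pair (suc n) zero (suc i) zero p = trans (subsetSum-zero n _)
    (trans (listSum-cong′ (subsetsOfSize n 0) (λ S → zeroʳ _)) (listSum-zero (subsetsOfSize n 0)))
  subsetSum-pair (suc (suc n)) zero (suc i) (suc l) p = trans (subsetSum-zero (suc n) _)
    (subsetSum-pair (suc n) zero i l (p ∘ ≡.cong suc))
  subsetSum-pair (suc n) (suc m) zero (suc l) p = trans (subsetSum-suc n m _)
    (trans (+-cong (trans (listSum-cong′ (subsetsOfSize n (suc m)) (λ S → zeroˡ _)) (listSum-zero (subsetsOfSize n (suc m))))
                   (listSum-cong′ (subsetsOfSize n m) (λ S → *-identityˡ (indicator S l))))
      (trans (+-identityˡ _) (subsetSum-indicator n m l)))
  subsetSum-pair (suc n) (suc m) (suc i) zero p = trans (subsetSum-suc n m _)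
    (trans (+-cong (trans (listSum-cong′ (subsetsOfSize n (suc m)) (λ S → zeroʳ _)) (listSum-zero (subsetsOfSize n (suc m))))
                   (listSum-cong′ (subsetsOfSize n m) (λ S → trans (*-comm _ _) (*-identityˡ (indicator S i)))))
      (trans (+-identityˡ _) (subsetSum-indicator n m i)))
  subsetSum-pair (suc (suc zero)) (suc m) (suc zero) (suc zero) p = contradiction ≡.refl p
  subsetSum-pair (suc (suc (suc n))) (suc m) (suc i) (suc l) p = trans (subsetSum-suc (suc (suc n)) m _)
    (trans (+-cong (subsetSum-pair (suc (suc n)) (suc m) i l (p ∘ ≡.cong suc))
                   (subsetSum-pair (suc (suc n)) m i l (p ∘ ≡.cong suc)))
      (pairCount-pascal n m))

  indicator-idem : ∀ {n} (S : Subset n) i → indicator S i * indicator S i ≈ indicator S i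
  indicator-idem S i with lookup S i
  ... | true  = *-identityˡ 1#
  ... | false = zeroˡ 0#

  indicator-nonneg : ∀ {n} (S : Subset n) i → 0# ≤ indicator S i
  indicator-nonneg S i with lookup S i
  ... | true  = 0≤1
  ... | false = ≤-refl

  indicator≤1 : ∀ {n} (S : Subset n) i → indicator S i ≤ 1#
  indicator≤1 S i with lookup S i
  ... | true  = ≤-refl
  ... | false = 0≤1

  sum-indicator : ∀ {n} (S : Subset n) → sum (indicator S) ≈ fromℕ ∣ S ∣
  sum-indicator Vec.[]              = refl
  sum-indicator (inside  Vec.∷ S) = +-congˡ (sum-indicator S)
  sum-indicator (outside Vec.∷ S) = trans (+-identityˡ _) (sum-indicator S)

  card-nonneg : ∀ n m → 0# ≤ card n m
  card-nonneg n m = ≤-respʳ (sym (listSum-one (subsetsOfSize n m))) (fromℕ-nonneg (length (subsetsOfSize n m)))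

  pointCount-nonneg : ∀ n m → 0# ≤ pointCount n m
  pointCount-nonneg (suc n) (suc m) = card-nonneg n m
  pointCount-nonneg zero    m       = ≤-refl
  pointCount-nonneg (suc n) zero    = ≤-refl

  pairCount-nonneg : ∀ n m → 0# ≤ pairCount n m
  pairCount-nonneg (suc n) (suc m) = pointCount-nonneg n m
  pairCount-nonneg zero    m       = ≤-refl
  pairCount-nonneg (suc n) zero    = ≤-refl

  pointCount≤card : ∀ n m → pointCount n m ≤ card n m
  pointCount≤card zero    m = card-nonneg zero m
  pointCount≤card (suc n) m = ≤-respˡ (subsetSum-indicator (suc n) m zero)
    (listSum-mono (subsetsOfSize (suc n) m) (λ S → indicator≤1 S zero))

  pairCount≤pointCount : ∀ n m → pairCount n m ≤ pointCount n m
  pairCount≤pointCount (suc n) (suc m) = pointCount≤card n m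
  pairCount≤pointCount zero    m       = ≤-refl
  pairCount≤pointCount (suc n) zero    = ≤-refl

  -- Second moments of a random subset

  δ : ∀ {n} → Fin n → Fin n → ℝ
  δ zero    zero    = 1#
  δ zero    (suc l) = 0#
  δ (suc i) zero    = 0#
  δ (suc i) (suc l) = δ i l

  δ-refl : ∀ {n} (i : Fin n) → δ i i ≡ 1#
  δ-refl zero    = ≡.refl
  δ-refl (suc i) = δ-refl i

  δ-≢ : ∀ {n} {i l : Fin n} → i ≢ l → δ i l ≡ 0#
  δ-≢ {i = zero}  {zero}  p = contradiction ≡.refl p
  δ-≢ {i = zero}  {suc l} p = ≡.refl
  δ-≢ {i = suc i} {zero}  p = ≡.refl
  δ-≢ {i = suc i} {suc l} p = δ-≢ (p ∘ ≡.cong suc)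

  sum-δ : ∀ {n} (i : Fin n) (x : Fin n → ℝ) → sum (λ l → δ i l * x l) ≈ x i
  sum-δ {suc n} zero    x = trans (+-cong (*-identityˡ (x zero)) (sum-zero {n} (λ l → zeroˡ (x (suc l))))) (+-identityʳ _)
  sum-δ         (suc i) x = trans (+-cong (zeroˡ (x zero)) (sum-δ i (x ∘ suc))) (+-identityˡ _)

  -- One formula for i = l and i ≠ l, so that sums over l can be evaluated with `sum-δ`.
  pairMoment : ∀ n m i l → subsetSum n m (λ S → indicator S i * indicator S l)
               ≈ pairCount n m + δ i l * (pointCount n m - pairCount n m)
  pairMoment n m i l with i Fin.≟ l
  ... | yes ≡.refl = trans (listSum-cong′ (subsetsOfSize n m) (λ S → indicator-idem S i))
    (trans (subsetSum-indicator n m i) (trans (solve 2 (λ p q → q := p :+ con (+ 1) :* (q :- p)) refl (pairCount n m) (pointCount n m))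
      (+-congˡ (*-congʳ (reflexive (≡.sym (δ-refl i)))))))
  ... | no  i≢l = trans (subsetSum-pair n m i l i≢l)
    (trans (solve 2 (λ p q → p := p :+ con (+ 0) :* (q :- p)) refl (pairCount n m) (pointCount n m))
      (+-congˡ (*-congʳ (reflexive (≡.sym (δ-≢ i≢l))))))

  sum-indicator-of-size : ∀ n m → All (λ S → sum (indicator S) ≈ fromℕ m) (subsetsOfSize n m)
  sum-indicator-of-size n m = All.map (λ {S} e → trans (sum-indicator S) (reflexive (≡.cong fromℕ e))) (subsetsOfSize-size n m)

  -- Counts the pairs (i, S) with i in S, first by S and then by i.
  double-count-points : ∀ n m → fromℕ m * card n m ≈ fromℕ n * pointCount n m
  double-count-points n m = begin
    fromℕ m * card n m
      ≈⟨ *-distribˡ-listSum (fromℕ m) Ω (λ _ → 1#) ⟩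
    listSum Ω (λ _ → fromℕ m * 1#)
      ≈⟨ listSum-cong (All.map (λ e → trans (trans (*-comm _ 1#) (*-identityˡ _)) (sym e)) (sum-indicator-of-size n m)) ⟩
    listSum Ω (λ S → sum (indicator S))
      ≈⟨ listSum-sum-comm Ω indicator ⟩
    sum (λ i → listSum Ω (λ S → indicator S i))
      ≈⟨ sum-cong (subsetSum-indicator n m) ⟩
    sum {n} (λ i → pointCount n m)
      ≈⟨ sum-const n (pointCount n m) ⟩
    fromℕ n * pointCount n m ∎
    where
    open ≈-Reasoning
    Ω = subsetsOfSize n m

  -- With i fixed, counts the pairs (l, S) with both i and l in S. The correction P₁ - P₂ comes from
  -- l = i, where only one point is prescribed.
  double-count-pairs : ∀ n m → Fin n → fromℕ m * pointCount n m
                       ≈ fromℕ n * pairCount n m + (pointCount n m - pairCount n m)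
  double-count-pairs n m i = begin
    fromℕ m * pointCount n m
      ≈⟨ *-congˡ (subsetSum-indicator n m i) ⟨
    fromℕ m * listSum Ω (λ S → indicator S i)
      ≈⟨ *-distribˡ-listSum (fromℕ m) Ω (λ S → indicator S i) ⟩
    listSum Ω (λ S → fromℕ m * indicator S i)
      ≈⟨ listSum-cong (All.map (λ {S} e → trans (*-comm _ _) (trans (*-congˡ (sym e))
           (*-distribˡ-sum (indicator S i) (indicator S)))) (sum-indicator-of-size n m)) ⟩
    listSum Ω (λ S → sum (λ l → indicator S i * indicator S l))
      ≈⟨ listSum-sum-comm Ω (λ S l → indicator S i * indicator S l) ⟩
    sum (λ l → listSum Ω (λ S → indicator S i * indicator S l))
      ≈⟨ sum-cong (pairMoment n m i) ⟩
    sum (λ l → pairCount n m + δ i l * (pointCount n m - pairCount n m))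
      ≈⟨ sum-distrib-+ (λ _ → pairCount n m) (λ l → δ i l * (pointCount n m - pairCount n m)) ⟩
    sum {n} (λ _ → pairCount n m) + sum (λ l → δ i l * (pointCount n m - pairCount n m))
      ≈⟨ +-cong (sum-const n (pairCount n m)) (sum-δ i (λ _ → pointCount n m - pairCount n m)) ⟩
    fromℕ n * pairCount n m + (pointCount n m - pairCount n m) ∎
    where
    open ≈-Reasoning
    Ω = subsetsOfSize n m

  -- By symmetry this matrix has one value on the diagonal and one off it. Its rows sum to zero
  -- because the deviations of a set of size m do, so it is a multiple of n I - J with J the
  -- all-ones matrix. The two double counts carry out this cancellation.
  centredMoment : ∀ n m (i l : Fin n) →
    subsetSum n m (λ S → (fromℕ n * indicator S i - fromℕ m) * (fromℕ n * indicator S l - fromℕ m))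
    ≈ (fromℕ n * (pointCount n m - pairCount n m)) * (fromℕ n * δ i l - 1#)
  centredMoment n m i l = begin
    listSum Ω (λ S → (ν * χ i S - μ) * (ν * χ l S - μ))
      ≈⟨ listSum-cong′ Ω (λ S → solve 4 (λ ν μ a b → (ν :* a :- μ) :* (ν :* b :- μ)
           := (ν :* ν) :* (a :* b) :+ (:- (ν :* μ) :* a :+ (:- (ν :* μ) :* b :+ (μ :* μ) :* con (+ 1))))
           refl ν μ (χ i S) (χ l S)) ⟩
    listSum Ω (λ S → (ν * ν) * (χ i S * χ l S) + (- (ν * μ) * χ i S + (- (ν * μ) * χ l S + (μ * μ) * 1#)))
      ≈⟨ trans (listSum-distrib-+ Ω (λ S → (ν * ν) * (χ i S * χ l S)) _)
           (+-cong (sym (*-distribˡ-listSum (ν * ν) Ω (λ S → χ i S * χ l S)))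
         (trans (listSum-distrib-+ Ω (λ S → - (ν * μ) * χ i S) _)
           (+-cong (sym (*-distribˡ-listSum (- (ν * μ)) Ω (χ i)))
         (trans (listSum-distrib-+ Ω (λ S → - (ν * μ) * χ l S) _)
           (+-cong (sym (*-distribˡ-listSum (- (ν * μ)) Ω (χ l)))
                   (sym (*-distribˡ-listSum (μ * μ) Ω (λ _ → 1#)))))))) ⟩
    (ν * ν) * listSum Ω (λ S → χ i S * χ l S)
      + (- (ν * μ) * listSum Ω (χ i) + (- (ν * μ) * listSum Ω (χ l) + (μ * μ) * card n m))
      ≈⟨ +-cong (*-congˡ (pairMoment n m i l))
           (+-cong (*-congˡ (subsetSum-indicator n m i)) (+-cong (*-congˡ (subsetSum-indicator n m l))
             (solve 2 (λ μ N → (μ :* μ) :* N := μ :* (μ :* N)) refl μ (card n m)))) ⟩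
    (ν * ν) * (P₂ + δ i l * (P₁ - P₂)) + (- (ν * μ) * P₁ + (- (ν * μ) * P₁ + μ * (μ * card n m)))
      ≈⟨ +-congˡ (+-congˡ (+-congˡ (*-congˡ (double-count-points n m)))) ⟩
    (ν * ν) * (P₂ + δ i l * (P₁ - P₂)) + (- (ν * μ) * P₁ + (- (ν * μ) * P₁ + μ * (ν * P₁)))
      ≈⟨ solve 5 (λ ν μ p q d → (ν :* ν) :* (q :+ d :* (p :- q)) :+ (:- (ν :* μ) :* p :+ (:- (ν :* μ) :* p :+ μ :* (ν :* p)))
           := (ν :* ν) :* (q :+ d :* (p :- q)) :- ν :* (μ :* p)) refl ν μ P₁ P₂ (δ i l) ⟩
    (ν * ν) * (P₂ + δ i l * (P₁ - P₂)) - ν * (μ * P₁)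
      ≈⟨ +-congˡ (-‿cong (*-congˡ (double-count-pairs n m i))) ⟩
    (ν * ν) * (P₂ + δ i l * (P₁ - P₂)) - ν * (ν * P₂ + (P₁ - P₂))
      ≈⟨ solve 4 (λ ν p q d → (ν :* ν) :* (q :+ d :* (p :- q)) :- ν :* (ν :* q :+ (p :- q))
           := (ν :* (p :- q)) :* (ν :* d :- con (+ 1))) refl ν P₁ P₂ (δ i l) ⟩
    (ν * (P₁ - P₂)) * (ν * δ i l - 1#) ∎
    where
    open ≈-Reasoning
    Ω = subsetsOfSize n m
    ν = fromℕ n
    μ = fromℕ m
    P₁ = pointCount n m
    P₂ = pairCount n m
    χ : Fin n → Subset n → ℝ
    χ i S = indicator S i

  -- By `centredMoment` the total over all sets is c (n tr H - 1ᵀH1) with c = n (P₁ - P₂).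
  -- Nonnegativity of the form at the constant vector lets the second term be dropped, and c n ≤ n²
  -- P₁ = n m `card n m`.
  sampling-variance : ∀ n m (H : Fin n → Fin n → ℝ) → 0# ≤ quadraticForm H (λ _ → 1#) → (∀ i → 0# ≤ H i i) →
    subsetSum n m (λ S → quadraticForm H (λ i → fromℕ n * indicator S i - fromℕ m))
    ≤ (fromℕ n * (fromℕ m * card n m)) * sum (λ i → H i i)
  sampling-variance n m H H≥0 Hᵢᵢ≥0 = begin
    listSum Ω (λ S → sum (λ i → sum (λ l → (a S i * a S l) * H i l)))
      ≈⟨ listSum-sum-comm Ω (λ S i → sum (λ l → (a S i * a S l) * H i l)) ⟩
    sum (λ i → listSum Ω (λ S → sum (λ l → (a S i * a S l) * H i l)))
      ≈⟨ sum-cong (λ i → listSum-sum-comm Ω (λ S l → (a S i * a S l) * H i l)) ⟩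
    sum (λ i → sum (λ l → listSum Ω (λ S → (a S i * a S l) * H i l)))
      ≈⟨ sum-cong (λ i → sum-cong (λ l → moment i l)) ⟩
    sum (λ i → sum (λ l → (c * ν) * (δ i l * H i l) - c * ((1# * 1#) * H i l)))
      ≈⟨ sum₂-distrib-- (λ i l → (c * ν) * (δ i l * H i l)) (λ i l → c * ((1# * 1#) * H i l)) ⟩
    sum (λ i → sum (λ l → (c * ν) * (δ i l * H i l))) - sum (λ i → sum (λ l → c * ((1# * 1#) * H i l)))
      ≈⟨ +-cong diagonal (-‿cong total) ⟩
    (c * ν) * sum (λ i → H i i) - c * quadraticForm H (λ _ → 1#)
      ≤⟨ y-x≈z≥0⇒x≤y (*-nonneg c≥0 H≥0) (solve 2 (λ x y → x :- (x :- y) := y) refl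
           ((c * ν) * sum (λ i → H i i)) (c * quadraticForm H (λ _ → 1#))) ⟩
    (c * ν) * sum (λ i → H i i)
      ≤⟨ *-monoʳ-≤ (sum-nonneg Hᵢᵢ≥0) (y-x≈z≥0⇒x≤y (*-nonneg (*-nonneg ν≥0 ν≥0) (pairCount-nonneg n m))
           (trans (+-congʳ (*-congˡ (double-count-points n m)))
             (solve 3 (λ ν p q → ν :* (ν :* p) :- (ν :* (p :- q)) :* ν := (ν :* ν) :* q) refl ν P₁ P₂))) ⟩
    (ν * (fromℕ m * card n m)) * sum (λ i → H i i) ∎
    where
    open ≤-Reasoning
    Ω = subsetsOfSize n m
    ν = fromℕ n
    P₁ = pointCount n m
    P₂ = pairCount n m
    c = ν * (P₁ - P₂)
    ν≥0 = fromℕ-nonneg n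
    c≥0 : 0# ≤ c
    c≥0 = *-nonneg ν≥0 (x≤y⇒0≤y-x (pairCount≤pointCount n m))
    a : Subset n → Fin n → ℝ
    a S i = ν * indicator S i - fromℕ m
    moment : ∀ i l → listSum Ω (λ S → (a S i * a S l) * H i l) ≈ (c * ν) * (δ i l * H i l) - c * ((1# * 1#) * H i l)
    moment i l = trans (listSum-cong′ Ω (λ S → *-comm (a S i * a S l) (H i l)))
      (trans (sym (*-distribˡ-listSum (H i l) Ω (λ S → a S i * a S l)))
        (trans (*-congˡ (centredMoment n m i l))
          (solve 4 (λ h c ν d → h :* (c :* (ν :* d :- con (+ 1)))
             := (c :* ν) :* (d :* h) :- c :* ((con (+ 1) :* con (+ 1)) :* h)) refl (H i l) c ν (δ i l))))
    diagonal : sum (λ i → sum (λ l → (c * ν) * (δ i l * H i l))) ≈ (c * ν) * sum (λ i → H i i)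
    diagonal = trans (sum-cong λ i → trans (sym (*-distribˡ-sum (c * ν) (λ l → δ i l * H i l)))
      (*-congˡ (sum-δ i (H i)))) (sym (*-distribˡ-sum (c * ν) (λ i → H i i)))
    total : sum (λ i → sum (λ l → c * ((1# * 1#) * H i l))) ≈ c * quadraticForm H (λ _ → 1#)
    total = trans (sum-cong λ i → sym (*-distribˡ-sum c (λ l → (1# * 1#) * H i l)))
      (sym (*-distribˡ-sum c (λ i → sum (λ l → (1# * 1#) * H i l))))

  -- Markov's inequality in counting form: an element outside `E` pays τ out of the sum of `F`, and
  -- one inside is charged τ directly. The `filter` is the one in `Pr`, so the count can be used
  -- there as it stands.
  markov : ∀ {A : Set} {E : A → Set} {F : A → ℝ} {τ} → 0# ≤ τ → (∀ x → 0# ≤ F x) →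
           ∀ {xs} → All (λ x → ¬ E x → τ ≤ F x) xs →
           fromℕ (length xs) * τ ≤ fromℕ (length (filter (λ x → lem {E x}) xs)) * τ + listSum xs F
  markov {τ = τ} 0≤τ F≥0 [] = ≤-reflexive (sym (+-identityʳ _))
  markov {E = E} {F} {τ} 0≤τ F≥0 {x ∷ xs} (p ∷ ps) with lem {E x}
  ... | yes _ = y-x≈z≥0⇒x≤y (+-nonneg (F≥0 x) (x≤y⇒0≤y-x (markov 0≤τ F≥0 ps)))
    (solve 5 (λ n g t f s → ((con (+ 1) :+ g) :* t :+ (f :+ s)) :- (con (+ 1) :+ n) :* t := f :+ ((g :* t :+ s) :- n :* t)) refl
      (fromℕ (length xs)) _ τ (F x) (listSum xs F))
  ... | no ¬e = y-x≈z≥0⇒x≤y (+-nonneg (x≤y⇒0≤y-x (p ¬e)) (x≤y⇒0≤y-x (markov 0≤τ F≥0 ps)))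
    (solve 5 (λ n g t f s → (g :* t :+ (f :+ s)) :- (con (+ 1) :+ n) :* t := (f :- t) :+ ((g :* t :+ s) :- n :* t)) refl
      (fromℕ (length xs)) _ τ (F x) (listSum xs F))

  0<length-subsetsOfSize : ∀ {n m} → m ℕ.≤ n → 1 ℕ.≤ length (subsetsOfSize n m)
  0<length-subsetsOfSize {zero}  ℕ.z≤n = ℕ.≤-refl
  0<length-subsetsOfSize {suc n} ℕ.z≤n = ℕ.≤-trans (0<length-subsetsOfSize {n} ℕ.z≤n) (ℕ.≤-reflexive (≡.sym
    (≡.trans (≡.cong length (subsetsOfSize-zero n)) (length-map _ (subsetsOfSize n 0)))))
  0<length-subsetsOfSize {suc n} {suc m} (ℕ.s≤s p) = ℕ.≤-trans (0<length-subsetsOfSize p) (ℕ.≤-trans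
    (ℕ.m≤n+m _ (length (List.map (outside Vec.∷_) (subsetsOfSize n (suc m)))))
    (ℕ.≤-reflexive (≡.sym (≡.trans (≡.cong length (subsetsOfSize-suc n m))
      (≡.trans (length-++ (List.map (outside Vec.∷_) (subsetsOfSize n (suc m))))
        (≡.cong (length (List.map (outside Vec.∷_) (subsetsOfSize n (suc m))) ℕ.+_) (length-map _ (subsetsOfSize n m))))))))

  -- Attention

  term≤sum : ∀ {n} {f : Fin n → ℝ} → (∀ i → 0# ≤ f i) → ∀ i → f i ≤ sum f
  term≤sum {f = f} 0≤f zero = y-x≈z≥0⇒x≤y (sum-nonneg (0≤f ∘ suc))
    (solve 2 (λ x y → (x :+ y) :- x := y) refl (f zero) (sum (f ∘ suc)))
  term≤sum {f = f} 0≤f (suc i) = ≤-trans (term≤sum (0≤f ∘ suc) i) (y-x≈z≥0⇒x≤y (0≤f zero)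
    (solve 2 (λ x y → (x :+ y) :- y := x) refl (f zero) (sum (f ∘ suc))))

  size≥1⇒nonempty : ∀ {n} (S : Subset n) → 1 ℕ.≤ ∣ S ∣ → Nonempty S
  size≥1⇒nonempty (inside  Vec.∷ S) _ = zero , Vec.here
  size≥1⇒nonempty (outside Vec.∷ S) p = let i , i∈S = size≥1⇒nonempty S p in suc i , Vec.there i∈S

  sumOver-indicator : ∀ {n} (S : Subset n) f → sumOver S f ≈ sum (λ i → indicator S i * f i)
  sumOver-indicator S f = sum-cong term
    where
    term : ∀ i → (if lookup S i then f i else 0#) ≈ indicator S i * f i
    term i with lookup S i
    ... | true  = sym (*-identityˡ (f i))
    ... | false = sym (zeroˡ (f i))

  indicator-⊤ : ∀ {n} (i : Fin n) → indicator ⊤ i ≈ 1#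
  indicator-⊤ i rewrite Vec.lookup-replicate i inside = refl

  sumOver-⊤ : ∀ {n} (f : Fin n → ℝ) → sumOver ⊤ f ≈ sum f
  sumOver-⊤ f = trans (sumOver-indicator ⊤ f)
    (sum-cong λ i → trans (*-congʳ (indicator-⊤ i)) (*-identityˡ (f i)))

  quadraticForm-zero : ∀ {n} (H : Fin n → Fin n → ℝ) {f} → (∀ i → f i ≈ 0#) → quadraticForm H f ≈ 0#
  quadraticForm-zero {n} H {f} f≈0 = sum-zero {n} λ i → sum-zero {n} λ l →
    trans (*-congʳ (trans (*-congʳ (f≈0 i)) (zeroˡ (f l)))) (zeroˡ (H i l))

  [x-y]²≤2[x²+y²] : ∀ x y → (x - y) * (x - y) ≤ (1# + 1#) * (x * x + y * y)
  [x-y]²≤2[x²+y²] x y = y-x≈z≥0⇒x≤y (x²≥0 (x + y))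
    (solve 2 (λ x y → (con (+ 1) :+ con (+ 1)) :* (x :* x :+ y :* y) :- (x :- y) :* (x :- y)
       := (x :+ y) :* (x :+ y)) refl x y)

  -- Error of attention on a fixed subset

  module _ {n dₖ dᵥ : ℕ} (1≤n : 1 ℕ.≤ n) (I : NormalisedInstance n dₖ dᵥ) {ρ : ℝ} (0≤ρ : 0# ≤ ρ) where
    open NormalisedInstance I

    ν : ℝ
    ν = fromℕ n

    ν>0 : 0# < ν
    ν>0 = fromℕ-pos 1≤n

    key-norm : ∀ i → ⟨ key i , key i ⟩ ≤ 1#
    key-norm i = ≤-respʳ (*-identityˡ 1#) (∥∥≤⇒⟨⟩≤ (key i) (key-bound i))

    value-norm : ∀ i → ⟨ value i , value i ⟩ ≤ 1#
    value-norm i = ≤-respʳ (*-identityˡ 1#) (∥∥≤⇒⟨⟩≤ (value i) (value-bound i))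

    key-sum : ∀ c → sum (λ i → key i c) ≈ 0#
    key-sum c = *-cancelˡ (0<⇒≉0 (⁻¹-pos ν>0)) (trans (key-centred c) (sym (zeroʳ (ν ⁻¹))))

    -- The `1#` in `kernel` amounts to extending each value by a constant coordinate 1. Numerator
    -- and normaliser are then controlled by a single quadratic form.
    keyKernel kernel : Fin n → Fin n → ℝ
    keyKernel i l = exp (ρ * ⟨ key i , key l ⟩)
    kernel i l = keyKernel i l * (⟨ value i , value l ⟩ + 1#)

    quadraticForm-kernel : ∀ f → quadraticForm kernel f
      ≈ sum (λ c → quadraticForm keyKernel (λ i → f i * value i c)) + quadraticForm keyKernel f
    quadraticForm-kernel f = begin
      sum (λ i → sum (λ l → (f i * f l) * kernel i l))
        ≈⟨ sum-cong (λ i → sum-cong (λ l → solve 3 (λ a k s → a :* (k :* (s :+ con (+ 1))) := (a :* k) :* s :+ a :* k)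
             refl (f i * f l) (keyKernel i l) ⟨ value i , value l ⟩)) ⟩
      sum (λ i → sum (λ l → ((f i * f l) * keyKernel i l) * ⟨ value i , value l ⟩ + (f i * f l) * keyKernel i l))
        ≈⟨ sum₂-distrib-+ (λ i l → ((f i * f l) * keyKernel i l) * ⟨ value i , value l ⟩)
                          (λ i l → (f i * f l) * keyKernel i l) ⟩
      sum (λ i → sum (λ l → ((f i * f l) * keyKernel i l) * ⟨ value i , value l ⟩)) + quadraticForm keyKernel f
        ≈⟨ +-congʳ (sum-cong (λ i → sum-cong (λ l → trans
             (*-distribˡ-sum ((f i * f l) * keyKernel i l) (λ c → value i c * value l c))
             (sum-cong (λ c → solve 5 (λ a b k x y → ((a :* b) :* k) :* (x :* y) := ((a :* x) :* (b :* y)) :* k)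
               refl (f i) (f l) (keyKernel i l) (value i c) (value l c)))))) ⟩
      sum (λ i → sum (λ l → sum (λ c → T c i l))) + quadraticForm keyKernel f
        ≈⟨ +-congʳ (trans (sum-cong (λ i → ∑-comm (λ l c → T c i l))) (∑-comm (λ i c → sum (λ l → T c i l)))) ⟩
      sum (λ c → quadraticForm keyKernel (λ i → f i * value i c)) + quadraticForm keyKernel f ∎
      where
      open ≈-Reasoning
      T : Fin dᵥ → Fin n → Fin n → ℝ
      T c i l = ((f i * value i c) * (f l * value l c)) * keyKernel i l

    -- The kernel inequality at p = 0 already gives this: a square is at most exp ρ times the form.
    quadraticForm-keyKernel-nonneg : ∀ f → 0# ≤ quadraticForm keyKernel f
    quadraticForm-keyKernel-nonneg f = *-cancelˡ-≤ (exp-pos ρ) (≤-respˡ (sym (zeroʳ (exp ρ)))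
      (≤-trans (x²≥0 (sum (λ i → f i * exp (ρ * ⟨ (λ _ → 0#) , key i ⟩))))
        (exp-kernel-≤ key {λ _ → 0#} (≤-respˡ (sym (sum-zero {dₖ} (λ _ → zeroˡ 0#))) 0≤1) 0≤ρ f)))

    quadraticForm-kernel-nonneg : ∀ f → 0# ≤ quadraticForm kernel f
    quadraticForm-kernel-nonneg f = ≤-respʳ (sym (quadraticForm-kernel f))
      (+-nonneg (sum-nonneg (λ c → quadraticForm-keyKernel-nonneg (λ i → f i * value i c)))
                (quadraticForm-keyKernel-nonneg f))

    kernel-diagonal-nonneg : ∀ i → 0# ≤ kernel i i
    kernel-diagonal-nonneg i = *-nonneg (proj₁ (exp-pos _)) (+-nonneg (⟨⟩-nonneg (value i)) 0≤1)

    kernel-diagonal-≤ : ∀ i → kernel i i ≤ exp ρ * (1# + 1#)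
    kernel-diagonal-≤ i = *-mono-≤ (proj₁ (exp-pos _)) (+-nonneg 0≤1 0≤1)
      (exp-mono (≤-respʳ (trans (*-comm ρ 1#) (*-identityˡ ρ)) (*-monoˡ-≤ 0≤ρ (key-norm i))))
      (+-mono-≤ (value-norm i) ≤-refl)

    kernel-trace-≤ : sum (λ i → kernel i i) ≤ ν * (exp ρ * (1# + 1#))
    kernel-trace-≤ = ≤-respʳ (sum-const n (exp ρ * (1# + 1#))) (sum-mono kernel-diagonal-≤)

    module _ (q : Fin dₖ → ℝ) (q≤ρ : ∥ q ∥ ≤ ρ) where

      weight : Fin n → ℝ
      weight i = exp ⟨ q , key i ⟩

      -- When `f` is the deviation, the left side is |X|² + Y², and the right side no longer
      -- mentions `q`. The kernel inequality is applied once for each value coordinate and once for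
      -- the constant coordinate.
      weighted-sums-≤ : ∀ f →
        sum (λ c → sum (λ i → (f i * value i c) * weight i) * sum (λ i → (f i * value i c) * weight i))
          + sum (λ i → f i * weight i) * sum (λ i → f i * weight i)
        ≤ exp ρ * quadraticForm kernel f
      weighted-sums-≤ f = let p , p≤1 , ρp≈q = rescale q 0≤ρ (∥∥≤⇒⟨⟩≤ q q≤ρ) in begin
        sum (λ c → sum (λ i → (f i * value i c) * weight i) * sum (λ i → (f i * value i c) * weight i))
          + sum (λ i → f i * weight i) * sum (λ i → f i * weight i)
          ≤⟨ +-mono-≤ (sum-mono (λ c → bound p p≤1 ρp≈q (λ i → f i * value i c))) (bound p p≤1 ρp≈q f) ⟩
        sum (λ c → exp ρ * quadraticForm keyKernel (λ i → f i * value i c)) + exp ρ * quadraticForm keyKernel f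
          ≈⟨ +-congʳ (*-distribˡ-sum (exp ρ) (λ c → quadraticForm keyKernel (λ i → f i * value i c))) ⟨
        exp ρ * sum (λ c → quadraticForm keyKernel (λ i → f i * value i c)) + exp ρ * quadraticForm keyKernel f
          ≈⟨ solve 3 (λ a b c → a :* b :+ a :* c := a :* (b :+ c)) refl (exp ρ)
               (sum (λ c → quadraticForm keyKernel (λ i → f i * value i c))) (quadraticForm keyKernel f) ⟩
        exp ρ * (sum (λ c → quadraticForm keyKernel (λ i → f i * value i c)) + quadraticForm keyKernel f)
          ≈⟨ *-congˡ (quadraticForm-kernel f) ⟨
        exp ρ * quadraticForm kernel f ∎
        where
        open ≤-Reasoning
        bound : ∀ p → ⟨ p , p ⟩ ≤ 1# → (∀ k → ρ * ⟨ p , k ⟩ ≈ ⟨ q , k ⟩) → ∀ g →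
          sum (λ i → g i * weight i) * sum (λ i → g i * weight i) ≤ exp ρ * quadraticForm keyKernel g
        bound p p≤1 ρp≈q g = ≤-respˡ (*-cong e e) (exp-kernel-≤ key {p} p≤1 0≤ρ g)
          where
          e : sum (λ i → g i * exp (ρ * ⟨ p , key i ⟩)) ≈ sum (λ i → g i * weight i)
          e = sum-cong λ i → *-congˡ (exp-cong (ρp≈q (key i)))

      weight-sum-≥ : ν ≤ sum weight
      weight-sum-≥ = begin
        ν
          ≈⟨ solve 1 (λ x → x := x :* con (+ 1) :+ con (+ 0)) refl ν ⟩
        ν * 1# + 0#
          ≈⟨ +-cong (sum-const n 1#) centred ⟨
        sum {n} (λ _ → 1#) + sum (λ i → ⟨ q , key i ⟩)
          ≈⟨ sum-distrib-+ {n} (λ _ → 1#) (λ i → ⟨ q , key i ⟩) ⟨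
        sum (λ i → 1# + ⟨ q , key i ⟩)
          ≤⟨ sum-mono (λ i → 1+x≤exp ⟨ q , key i ⟩) ⟩
        sum weight ∎
        where
        open ≤-Reasoning
        centred : sum (λ i → ⟨ q , key i ⟩) ≈ 0#
        centred = trans (∑-comm (λ i c → q c * key i c)) (sum-zero {dₖ} λ c →
          trans (sym (*-distribˡ-sum (q c) (λ i → key i c))) (trans (*-congˡ (key-sum c)) (zeroʳ (q c))))

      module _ {S : Subset n} (S≥1 : 1 ℕ.≤ ∣ S ∣) where

        w : Fin n → ℝ
        w i = indicator S i * weight i

        w≥0 : ∀ i → 0# ≤ w i
        w≥0 i = *-nonneg (indicator-nonneg S i) (proj₁ (exp-pos _))

        w-sum>0 : 0# < sum w
        w-sum>0 = let i , i∈S = size≥1⇒nonempty S S≥1 in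
          <-≤-trans (exp-pos ⟨ q , key i ⟩) (≤-respˡ (trans (*-congʳ (member i i∈S)) (*-identityˡ (weight i)))
            (term≤sum w≥0 i))
          where
          member : ∀ i → i ∈ S → indicator S i ≈ 1#
          member i i∈S rewrite Vec.[]=⇒lookup i∈S = refl

        Aₛ A : Fin dᵥ → ℝ
        Aₛ = AttnOn I S q
        A = Attn I q

        sum-*-AttnOn : ∀ c → sum w * Aₛ c ≈ sum (λ i → w i * value i c)
        sum-*-AttnOn c = trans (*-congʳ (sym (sumOver-indicator S weight)))
          (trans (/-*-cancel λ e → 0<⇒≉0 w-sum>0 (trans (sym (sumOver-indicator S weight)) e))
            (trans (sumOver-indicator S (λ i → weight i * value i c))
              (sum-cong λ i → sym (*-assoc (indicator S i) (weight i) (value i c)))))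

        sum-*-Attn : ∀ c → sum weight * A c ≈ sum (λ i → weight i * value i c)
        sum-*-Attn c = trans (*-congʳ (sym (sumOver-⊤ weight)))
          (trans (/-*-cancel λ e → 0<⇒≉0 (<-≤-trans ν>0 weight-sum-≥) (trans (sym (sumOver-⊤ weight)) e))
            (sumOver-⊤ (λ i → weight i * value i c)))

        -- The output is a convex combination of values of norm at most 1. Jensen's inequality is
        -- applied in each coordinate after clearing the normaliser `sum w`.
        AttnOn-norm : ⟨ Aₛ , Aₛ ⟩ ≤ 1#
        AttnOn-norm = *-cancelˡ-≤ (*-pos w-sum>0 w-sum>0) (begin
          (sum w * sum w) * ⟨ Aₛ , Aₛ ⟩
            ≈⟨ *-distribˡ-sum (sum w * sum w) (λ c → Aₛ c * Aₛ c) ⟩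
          sum (λ c → (sum w * sum w) * (Aₛ c * Aₛ c))
            ≈⟨ sum-cong (λ c → trans (solve 2 (λ s a → (s :* s) :* (a :* a) := (s :* a) :* (s :* a)) refl (sum w) (Aₛ c))
                 (*-cong (sum-*-AttnOn c) (sum-*-AttnOn c))) ⟩
          sum (λ c → sum (λ i → w i * value i c) * sum (λ i → w i * value i c))
            ≤⟨ sum-mono (λ c → jensen-square w (λ i → value i c) w≥0) ⟩
          sum (λ c → sum w * sum (λ i → w i * (value i c * value i c)))
            ≈⟨ *-distribˡ-sum (sum w) (λ c → sum (λ i → w i * (value i c * value i c))) ⟨
          sum w * sum (λ c → sum (λ i → w i * (value i c * value i c)))
            ≈⟨ *-congˡ (trans (∑-comm (λ c i → w i * (value i c * value i c)))
                 (sum-cong λ i → sym (*-distribˡ-sum (w i) (λ c → value i c * value i c)))) ⟩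
          sum w * sum (λ i → w i * ⟨ value i , value i ⟩)
            ≤⟨ *-monoˡ-≤ (proj₁ w-sum>0) (sum-mono (λ i → ≤-respʳ (trans (*-comm (w i) 1#) (*-identityˡ (w i)))
                 (*-monoˡ-≤ (w≥0 i) (value-norm i)))) ⟩
          sum w * sum w
            ≈⟨ trans (*-comm _ 1#) (*-identityˡ _) ⟨
          (sum w * sum w) * 1# ∎)
          where open ≤-Reasoning

        module _ (m : ℕ) where

          deviation : Fin n → ℝ
          deviation i = ν * indicator S i - fromℕ m

          X : Fin dᵥ → ℝ
          X c = sum λ i → (deviation i * value i c) * weight i

          Y : ℝ
          Y = sum λ i → deviation i * weight i

          deviation-sum : ∀ (x : Fin n → ℝ) → sum (λ i → deviation i * x i)
                          ≈ ν * sum (λ i → indicator S i * x i) - fromℕ m * sum x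
          deviation-sum x = trans (sum-cong λ i → solve 4 (λ ν χ μ x → (ν :* χ :- μ) :* x := ν :* (χ :* x) :- μ :* x)
              refl ν (indicator S i) (fromℕ m) (x i))
            (trans (sum-distrib-- (λ i → ν * (indicator S i * x i)) (λ i → fromℕ m * x i))
              (+-cong (sym (*-distribˡ-sum ν (λ i → indicator S i * x i))) (-‿cong (sym (*-distribˡ-sum (fromℕ m) x)))))

          -- Multiplying Y by Attn_S rather than by Attn makes the two terms that contain the sample
          -- normaliser `sum w` cancel. What remains carries the full normaliser `sum weight`.
          error-identity : ∀ c → (fromℕ m * sum weight) * (Aₛ c - A c) ≈ X c - Aₛ c * Y
          error-identity c = sym (begin
            X c - Aₛ c * Y
              ≈⟨ +-cong Xc (-‿cong (*-congˡ (deviation-sum weight))) ⟩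
            (ν * (sum w * Aₛ c) - fromℕ m * (sum weight * A c)) - Aₛ c * (ν * sum w - fromℕ m * sum weight)
              ≈⟨ solve 6 (λ ν s a μ t b → (ν :* (s :* a) :- μ :* (t :* b)) :- a :* (ν :* s :- μ :* t)
                   := (μ :* t) :* (a :- b)) refl ν (sum w) (Aₛ c) (fromℕ m) (sum weight) (A c) ⟩
            (fromℕ m * sum weight) * (Aₛ c - A c) ∎)
            where
            open ≈-Reasoning
            Xc : X c ≈ ν * (sum w * Aₛ c) - fromℕ m * (sum weight * A c)
            Xc = trans (sum-cong λ i → solve 3 (λ d v w → (d :* v) :* w := d :* (w :* v)) refl
                         (deviation i) (value i c) (weight i))
              (trans (deviation-sum (λ i → weight i * value i c))
                (+-cong (*-congˡ (trans (sum-cong λ i → sym (*-assoc (indicator S i) (weight i) (value i c)))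
                          (sym (sum-*-AttnOn c))))
                        (-‿cong (*-congˡ (sym (sum-*-Attn c))))))

          error-≤ : (fromℕ m * ν * (fromℕ m * ν)) * ⟨ (λ c → Aₛ c - A c) , (λ c → Aₛ c - A c) ⟩
                    ≤ ((1# + 1#) * exp ρ) * quadraticForm kernel deviation
          error-≤ = begin
            (μ * ν * (μ * ν)) * ⟨ e , e ⟩
              ≤⟨ *-monoʳ-≤ (⟨⟩-nonneg e) (*-mono-≤ 0≤μν (≤-trans 0≤μν μν≤) μν≤ μν≤) ⟩
            (μ * D * (μ * D)) * ⟨ e , e ⟩
              ≈⟨ *-distribˡ-sum (μ * D * (μ * D)) (λ c → e c * e c) ⟩
            sum (λ c → (μ * D * (μ * D)) * (e c * e c))
              ≈⟨ sum-cong (λ c → trans (solve 2 (λ s a → (s :* s) :* (a :* a) := (s :* a) :* (s :* a)) refl (μ * D) (e c))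
                   (*-cong (error-identity c) (error-identity c))) ⟩
            sum (λ c → (X c - Aₛ c * Y) * (X c - Aₛ c * Y))
              ≤⟨ sum-mono (λ c → [x-y]²≤2[x²+y²] (X c) (Aₛ c * Y)) ⟩
            sum (λ c → (1# + 1#) * (X c * X c + (Aₛ c * Y) * (Aₛ c * Y)))
              ≈⟨ *-distribˡ-sum (1# + 1#) (λ c → X c * X c + (Aₛ c * Y) * (Aₛ c * Y)) ⟨
            (1# + 1#) * sum (λ c → X c * X c + (Aₛ c * Y) * (Aₛ c * Y))
              ≈⟨ *-congˡ (trans (sum-distrib-+ (λ c → X c * X c) (λ c → (Aₛ c * Y) * (Aₛ c * Y)))
                   (+-congˡ (trans (sum-cong λ c → solve 2 (λ a y → (a :* y) :* (a :* y) := (y :* y) :* (a :* a)) refl (Aₛ c) Y)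
                     (sym (*-distribˡ-sum (Y * Y) (λ c → Aₛ c * Aₛ c)))))) ⟩
            (1# + 1#) * (sum (λ c → X c * X c) + (Y * Y) * ⟨ Aₛ , Aₛ ⟩)
              ≤⟨ *-monoˡ-≤ (+-nonneg 0≤1 0≤1) (+-mono-≤ ≤-refl (*-monoˡ-≤ (x²≥0 Y) AttnOn-norm)) ⟩
            (1# + 1#) * (sum (λ c → X c * X c) + (Y * Y) * 1#)
              ≈⟨ *-congˡ (+-congˡ (trans (*-comm (Y * Y) 1#) (*-identityˡ (Y * Y)))) ⟩
            (1# + 1#) * (sum (λ c → X c * X c) + Y * Y)
              ≤⟨ *-monoˡ-≤ (+-nonneg 0≤1 0≤1) (weighted-sums-≤ deviation) ⟩
            (1# + 1#) * (exp ρ * quadraticForm kernel deviation)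
              ≈⟨ *-assoc (1# + 1#) (exp ρ) _ ⟨
            ((1# + 1#) * exp ρ) * quadraticForm kernel deviation ∎
            where
            open ≤-Reasoning
            μ = fromℕ m
            D = sum weight
            e : Fin dᵥ → ℝ
            e c = Aₛ c - A c
            0≤μν : 0# ≤ μ * ν
            0≤μν = *-nonneg (fromℕ-nonneg m) (proj₁ ν>0)
            μν≤ : μ * ν ≤ μ * D
            μν≤ = *-monoˡ-≤ (fromℕ-nonneg m) weight-sum-≥

  -- From the mean discrepancy to the two claims

  exp-double : ∀ ρ → exp ρ * exp ρ ≈ exp (fromℕ 2 * ρ)
  exp-double ρ = trans (exp-+ ρ ρ) (exp-cong (solve 1 (λ r → r :+ r := con (+ 2) :* r) refl ρ))

  fromℕ≉0⇒1≤ : ∀ n → fromℕ n ≉ 0# → 1 ℕ.≤ n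
  fromℕ≉0⇒1≤ zero    p = contradiction refl p
  fromℕ≉0⇒1≤ (suc n) p = ℕ.s≤s ℕ.z≤n

  all-satisfied : ∀ {A : Set} {P : A → Set} {xs} → All P xs → 1 ℕ.≤ length xs → ∃ P
  all-satisfied {xs = x ∷ xs} (p ∷ _) _ = x , p

  3n≤4g⇒3/4≤g/n : ∀ {g n} → 0# < n → fromℕ 3 * n ≤ fromℕ 4 * g → fromℕ 3 / fromℕ 4 ≤ g / n
  3n≤4g⇒3/4≤g/n {g} {n} 0<n p = *-cancelˡ-≤ (*-pos 0<n 0<4) (≤-respˡ
    (trans (*-comm _ n) (trans (*-congˡ (sym (/-*-cancel (0<⇒≉0 0<4)))) (sym (*-assoc n _ _))))
    (≤-respʳ (trans (*-congˡ (sym (/-*-cancel (0<⇒≉0 0<n))))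
      (solve 3 (λ a b c → a :* (b :* c) := (b :* a) :* c) refl (fromℕ 4) n (g / n))) p))
    where
    0<4 : 0# < fromℕ 4
    0<4 = fromℕ-pos {4} (ℕ.s≤s ℕ.z≤n)

  module _ {n dₖ dᵥ : ℕ} (1≤n : 1 ℕ.≤ n) (I : NormalisedInstance n dₖ dᵥ)
           {ε ρ : ℝ} (0<ε : 0# < ε) (0≤ρ : 0# ≤ ρ) where

    -- `SupError≤` also asks that the supremum exist. Completeness provides it: the query 0 makes
    -- the set of errors inhabited, and ε bounds it above.
    ∥error∥≤ε⇒SupError≤ : ∀ {S} → (∀ q → ∥ q ∥ ≤ ρ → ∥ (λ c → AttnOn I S q c - Attn I q c) ∥ ≤ ε) → SupError≤ I ρ ε S
    ∥error∥≤ε⇒SupError≤ {S} h = let s , isSup = complete (Error I ρ S) (_ , q₀ , q₀≤ρ , refl) (ε , upper) in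
      s , isSup , proj₂ isSup ε upper
      where
      q₀ : Fin dₖ → ℝ
      q₀ _ = 0#
      q₀≤ρ : ∥ q₀ ∥ ≤ ρ
      q₀≤ρ = ⟨⟩≤⇒∥∥≤ q₀ 0≤ρ (≤-respˡ (sym (sum-zero {dₖ} (λ _ → zeroˡ 0#))) (x²≥0 ρ))
      upper : IsUpperBound _≤_ (Error I ρ S) ε
      upper x (q , q≤ρ , x≈) = ≤-respˡ (sym x≈) (h q q≤ρ)

    -- The scale (m n)² is that of the left side of `error-≤`, so `threshold` is ε² with the
    -- denominators cleared.
    μν² threshold : ℕ → ℝ
    μν² m = fromℕ m * fromℕ n * (fromℕ m * fromℕ n)
    threshold m = μν² m * (ε * ε)

    -- The right side of `error-≤`. It depends on S alone, so a single comparison with `threshold`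
    -- settles all queries, and Markov's inequality can be applied to it.
    discrepancy : ℕ → Subset n → ℝ
    discrepancy m S = ((1# + 1#) * exp ρ) * quadraticForm (kernel 1≤n I 0≤ρ) (λ i → fromℕ n * indicator S i - fromℕ m)

    discrepancy-nonneg : ∀ m S → 0# ≤ discrepancy m S
    discrepancy-nonneg m S = *-nonneg (*-nonneg (+-nonneg 0≤1 0≤1) (proj₁ (exp-pos ρ)))
      (quadraticForm-kernel-nonneg 1≤n I 0≤ρ (λ i → fromℕ n * indicator S i - fromℕ m))

    μν²-pos : ∀ {m} → 1 ℕ.≤ m → 0# < μν² m
    μν²-pos 1≤m = let p = *-pos (fromℕ-pos 1≤m) (fromℕ-pos 1≤n) in *-pos p p

    discrepancy≤threshold⇒SupError≤ : ∀ {m S} → 1 ℕ.≤ m → ∣ S ∣ ≡ m → discrepancy m S ≤ threshold m → SupError≤ I ρ ε S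
    discrepancy≤threshold⇒SupError≤ {m} {S} 1≤m S≡m p = ∥error∥≤ε⇒SupError≤ {S} λ q q≤ρ →
      ⟨⟩≤⇒∥∥≤ (λ c → AttnOn I S q c - Attn I q c) (proj₁ 0<ε)
      (*-cancelˡ-≤ (μν²-pos 1≤m) (≤-trans
        (error-≤ 1≤n I 0≤ρ q q≤ρ {S} (ℕ.≤-trans 1≤m (ℕ.≤-reflexive (≡.sym S≡m))) m) p))

    large-discrepancy : ∀ m → 1 ℕ.≤ m → All (λ S → ¬ SupError≤ I ρ ε S → threshold m ≤ discrepancy m S) (subsetsOfSize n m)
    large-discrepancy m 1≤m = All.map (λ {S} S≡m ¬good → ≮⇒≥ λ lt →
      ¬good (discrepancy≤threshold⇒SupError≤ {m} {S} 1≤m S≡m (proj₁ lt))) (subsetsOfSize-size n m)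

    -- The factor 4 exp (2ρ) is 2 exp ρ from the definition of `discrepancy` times 2 exp ρ from each
    -- diagonal entry of the kernel.
    total-discrepancy-≤ : ∀ m → subsetSum n m (discrepancy m)
      ≤ (fromℕ 4 * exp (fromℕ 2 * ρ)) * (fromℕ n * fromℕ n * (fromℕ m * card n m))
    total-discrepancy-≤ m = begin
      subsetSum n m (discrepancy m)
        ≈⟨ *-distribˡ-listSum (two * exp ρ) (subsetsOfSize n m) Z ⟨
      (two * exp ρ) * subsetSum n m Z
        ≤⟨ *-monoˡ-≤ (*-nonneg (+-nonneg 0≤1 0≤1) (proj₁ (exp-pos ρ)))
             (sampling-variance n m H (quadraticForm-kernel-nonneg 1≤n I 0≤ρ (λ _ → 1#)) (kernel-diagonal-nonneg 1≤n I 0≤ρ)) ⟩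
      (two * exp ρ) * ((fromℕ n * (fromℕ m * card n m)) * sum (λ i → H i i))
        ≤⟨ *-monoˡ-≤ (*-nonneg (+-nonneg 0≤1 0≤1) (proj₁ (exp-pos ρ)))
             (*-monoˡ-≤ (*-nonneg (fromℕ-nonneg n) (*-nonneg (fromℕ-nonneg m) (card-nonneg n m))) (kernel-trace-≤ 1≤n I 0≤ρ)) ⟩
      (two * exp ρ) * ((fromℕ n * (fromℕ m * card n m)) * (fromℕ n * (exp ρ * two)))
        ≈⟨ solve 4 (λ e ν μ N → ((con (+ 1) :+ con (+ 1)) :* e) :* ((ν :* (μ :* N)) :* (ν :* (e :* (con (+ 1) :+ con (+ 1)))))
             := (con (+ 4) :* (e :* e)) :* (ν :* ν :* (μ :* N))) refl (exp ρ) (fromℕ n) (fromℕ m) (card n m) ⟩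
      (fromℕ 4 * (exp ρ * exp ρ)) * (fromℕ n * fromℕ n * (fromℕ m * card n m))
        ≈⟨ *-congʳ (*-congˡ (exp-double ρ)) ⟩
      (fromℕ 4 * exp (fromℕ 2 * ρ)) * (fromℕ n * fromℕ n * (fromℕ m * card n m)) ∎
      where
      open ≤-Reasoning
      two = 1# + 1#
      H = kernel 1≤n I 0≤ρ
      Z : Subset n → ℝ
      Z S = quadraticForm H (λ i → fromℕ n * indicator S i - fromℕ m)

    full-discrepancy : subsetSum n n (discrepancy n) ≈ 0#
    full-discrepancy = trans (listSum-cong (All.map (λ {S} → zero-discrepancy {S}) (subsetsOfSize-size n n)))
      (listSum-zero (subsetsOfSize n n))
      where
      zero-discrepancy : ∀ {S} → ∣ S ∣ ≡ n → discrepancy n S ≈ 0#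
      zero-discrepancy {S} e with Subset.∣p∣≡n⇒p≡⊤ {p = S} e
      ... | ≡.refl = trans (*-congˡ (quadraticForm-zero (kernel 1≤n I 0≤ρ) λ i →
        trans (+-congʳ (trans (*-congˡ (indicator-⊤ i)) (trans (*-comm _ 1#) (*-identityˡ _)))) (-‿inverseʳ (fromℕ n))))
        (zeroʳ _)

    -- The alternatives mirror the two values a minimum with n can take. The 16 is 4 · 4: one 4 from
    -- `total-discrepancy-≤`, the other from allowing failure probability 1/4.
    Sufficient : ℕ → Set
    Sufficient m = m ≡ n ⊎ fromℕ 16 * exp (fromℕ 2 * ρ) ≤ fromℕ m * (ε * ε)

    4*total-discrepancy-≤ : ∀ {m} → Sufficient m → fromℕ 4 * subsetSum n m (discrepancy m) ≤ card n m * threshold m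
    4*total-discrepancy-≤ (inj₁ ≡.refl) = ≤-respˡ (sym (trans (*-congˡ full-discrepancy) (zeroʳ _)))
      (*-nonneg (card-nonneg n n) (*-nonneg (x²≥0 _) (x²≥0 ε)))
    4*total-discrepancy-≤ {m} (inj₂ p) = begin
      fromℕ 4 * subsetSum n m (discrepancy m)
        ≤⟨ *-monoˡ-≤ (fromℕ-nonneg 4) (total-discrepancy-≤ m) ⟩
      fromℕ 4 * ((fromℕ 4 * exp (fromℕ 2 * ρ)) * (fromℕ n * fromℕ n * (fromℕ m * card n m)))
        ≈⟨ solve 2 (λ e x → con (+ 4) :* ((con (+ 4) :* e) :* x) := (con (+ 16) :* e) :* x) refl
             (exp (fromℕ 2 * ρ)) (fromℕ n * fromℕ n * (fromℕ m * card n m)) ⟩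
      (fromℕ 16 * exp (fromℕ 2 * ρ)) * (fromℕ n * fromℕ n * (fromℕ m * card n m))
        ≤⟨ *-monoʳ-≤ (*-nonneg (x²≥0 (fromℕ n)) (*-nonneg (fromℕ-nonneg m) (card-nonneg n m))) p ⟩
      (fromℕ m * (ε * ε)) * (fromℕ n * fromℕ n * (fromℕ m * card n m))
        ≈⟨ solve 4 (λ ν μ N e → (μ :* e) :* (ν :* ν :* (μ :* N)) := N :* (μ :* ν :* (μ :* ν) :* e)) refl
             (fromℕ n) (fromℕ m) (card n m) (ε * ε) ⟩
      card n m * threshold m ∎
      where open ≤-Reasoning

    good : ℕ → List (Subset n)
    good m = filter (λ S → lem {SupError≤ I ρ ε S}) (subsetsOfSize n m)

    -- Let N count all sets and G the good ones, let F be the total discrepancy and τ the threshold.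
    -- Markov gives N τ ≤ G τ + F, and sufficiency gives 4 F ≤ N τ. Four times the first plus the
    -- second is 3 N τ ≤ 4 G τ, and τ > 0 cancels.
    most-good : ∀ {m} → 1 ℕ.≤ m → Sufficient m →
                fromℕ 3 * fromℕ (length (subsetsOfSize n m)) ≤ fromℕ 4 * fromℕ (length (good m))
    most-good {m} 1≤m suf = *-cancelˡ-≤ 0<τ (y-x≈z≥0⇒x≤y
      (+-nonneg (*-nonneg (fromℕ-nonneg 4) (x≤y⇒0≤y-x (markov (proj₁ 0<τ) (discrepancy-nonneg m) (large-discrepancy m 1≤m))))
                (x≤y⇒0≤y-x (≤-respʳ (*-congʳ (listSum-one (subsetsOfSize n m))) (4*total-discrepancy-≤ suf))))
      (solve 4 (λ τ N G F → τ :* (con (+ 4) :* G) :- τ :* (con (+ 3) :* N)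
         := con (+ 4) :* ((G :* τ :+ F) :- N :* τ) :+ (N :* τ :- con (+ 4) :* F)) refl
         (threshold m) (fromℕ (length (subsetsOfSize n m))) (fromℕ (length (good m))) (subsetSum n m (discrepancy m))))
      where
      0<τ : 0# < threshold m
      0<τ = *-pos (μν²-pos 1≤m) (*-pos 0<ε 0<ε)

    module _ {m : ℕ} (1≤m : 1 ℕ.≤ m) (m≤n : m ℕ.≤ n) (suf : Sufficient m) where

      subsets-pos : 0# < fromℕ (length (subsetsOfSize n m))
      subsets-pos = fromℕ-pos (0<length-subsetsOfSize m≤n)

      random-subset : fromℕ 3 / fromℕ 4 ≤ Pr (subsetsOfSize n m) (SupError≤ I ρ ε)
      random-subset = 3n≤4g⇒3/4≤g/n subsets-pos (most-good 1≤m suf)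

      good-nonempty : 1 ℕ.≤ length (good m)
      good-nonempty = fromℕ≉0⇒1≤ (length (good m)) λ e →
        <⇒≱ (*-pos (fromℕ-pos {3} (ℕ.s≤s ℕ.z≤n)) subsets-pos)
          (≤-respʳ (trans (*-congˡ e) (zeroʳ _)) (most-good 1≤m suf))

      -- The probabilistic method: at least three quarters of a nonempty list of sets are good, so
      -- the list of good sets has a first element, whose size is exactly m.
      good-subset : ∃ λ S → Nonempty S ∧ SupError≤ I ρ ε S ∧ ∣ S ∣ ℕ.≤ m
      good-subset = let S , S-good , S≡m = all-satisfied (All.zip
                          ( all-filter (λ S → lem {SupError≤ I ρ ε S}) (subsetsOfSize n m)
                          , filter⁺ (λ S → lem {SupError≤ I ρ ε S}) (subsetsOfSize-size n m))) good-nonempty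
                    in S , size≥1⇒nonempty S (ℕ.≤-trans 1≤m (ℕ.≤-reflexive (≡.sym S≡m))) , S-good , ℕ.≤-reflexive S≡m

    module _ (K : ℕ) (16≤K : 16 ℕ.≤ K) where

      private
        x = fromℕ K * exp (fromℕ 2 * ρ) / (ε ^ 2)
        m = n ⊓ ⌈ x ⌉
        ε²>0 : 0# < ε ^ 2
        ε²>0 = *-pos 0<ε (*-pos 0<ε 0<1)
        x>0 : 0# < x
        x>0 = /-pos (*-pos (fromℕ-pos {K} (ℕ.≤-trans (ℕ.s≤s ℕ.z≤n) 16≤K)) (exp-pos _)) ε²>0
        1≤⌈x⌉ : 1 ℕ.≤ ⌈ x ⌉
        1≤⌈x⌉ = fromℕ≉0⇒1≤ ⌈ x ⌉ λ e → <⇒≱ x>0 (≤-respʳ e (≤⌈⌉ x))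

      sampleSize-pos : 1 ℕ.≤ m
      sampleSize-pos = ℕ.⊓-glb 1≤n 1≤⌈x⌉

      -- If the minimum is the ceiling, then x ≤ ⌈x⌉ gives m ε² ≥ K exp (2ρ), and K ≥ 16 is enough.
      -- The two claims take K = 32 and K = 128.
      sampleSize-sufficient : Sufficient m
      sampleSize-sufficient = Sum.map₂ (λ e → begin
        fromℕ 16 * exp (fromℕ 2 * ρ)  ≤⟨ *-monoʳ-≤ (proj₁ (exp-pos _)) (fromℕ-mono-≤ 16≤K) ⟩
        fromℕ K * exp (fromℕ 2 * ρ)   ≈⟨ /-*-cancel (0<⇒≉0 ε²>0) ⟨
        ε ^ 2 * x                     ≤⟨ *-monoˡ-≤ (proj₁ ε²>0) (≤⌈⌉ x) ⟩
        ε ^ 2 * fromℕ ⌈ x ⌉           ≈⟨ solve 2 (λ e M → (e :* (e :* con (+ 1))) :* M := M :* (e :* e)) refl ε (fromℕ ⌈ x ⌉) ⟩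
        fromℕ ⌈ x ⌉ * (ε * ε)         ≡⟨ ≡.cong (λ k → fromℕ k * (ε * ε)) e ⟨
        fromℕ m * (ε * ε)             ∎) (ℕ.⊓-sel n ⌈ x ⌉)
        where open ≤-Reasoning

  main : (n dₖ dᵥ : ℕ) → 1 ℕ.≤ n → 1 ℕ.≤ dₖ → 1 ℕ.≤ dᵥ →
    (ε ρ : ℝ) → 0# < ε → ε ≤ 1# → 0# ≤ ρ →
    (I : NormalisedInstance n dₖ dᵥ) →
    (∃ λ S → Nonempty S ∧ SupError≤ I ρ ε S ∧
      ∣ S ∣ ℕ.≤ n ⊓ ⌈ fromℕ 32 * exp (fromℕ 2 * ρ) / (ε ^ 2) ⌉)
    ∧
    (fromℕ 3 / fromℕ 4 ≤
      Pr (subsetsOfSize n (n ⊓ ⌈ fromℕ 128 * exp (fromℕ 2 * ρ) / (ε ^ 2) ⌉))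
         (SupError≤ I ρ ε))
  main n dₖ dᵥ 1≤n _ _ ε ρ 0<ε _ 0≤ρ I =
      good-subset 1≤n I 0<ε 0≤ρ (sampleSize-pos 1≤n I 0<ε 0≤ρ 32 16≤32) (ℕ.m⊓n≤m n _)
        (sampleSize-sufficient 1≤n I 0<ε 0≤ρ 32 16≤32)
    , random-subset 1≤n I 0<ε 0≤ρ (sampleSize-pos 1≤n I 0<ε 0≤ρ 128 16≤128) (ℕ.m⊓n≤m n _)
        (sampleSize-sufficient 1≤n I 0<ε 0≤ρ 128 16≤128)
    where
    16≤32 : 16 ℕ.≤ 32
    16≤32 = ℕ.m≤m+n 16 16
    16≤128 : 16 ℕ.≤ 128
    16≤128 = ℕ.m≤m+n 16 112

theorem3p7 : (lem : ExcludedMiddle 0ℓ) (R : CompleteOrderedField) →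
  let open Attention lem R in
  (n dₖ dᵥ : ℕ) → 1 ℕ.≤ n → 1 ℕ.≤ dₖ → 1 ℕ.≤ dᵥ →
  (ε ρ : ℝ) → 0# < ε → ε ≤ 1# → 0# ≤ ρ →
  (I : NormalisedInstance n dₖ dᵥ) →
  (∃ λ S → Nonempty S ∧ SupError≤ I ρ ε S ∧
    ∣ S ∣ ℕ.≤ n ⊓ ⌈ fromℕ 32 * exp (fromℕ 2 * ρ) / (ε ^ 2) ⌉)
  ∧
  (fromℕ 3 / fromℕ 4 ≤
    Pr (subsetsOfSize n (n ⊓ ⌈ fromℕ 128 * exp (fromℕ 2 * ρ) / (ε ^ 2) ⌉))
       (SupError≤ I ρ ε))
theorem3p7 = Proof.main
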